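{- Let $\Gamma$ be a connected signed graph with $n$ vertices and $m$ edges, and let $\mu_1\ge\mu_2\ge\cdots\ge\mu_n\ge 0$ be the eigenvalues of its Laplacian matrix $L(\Gamma)$ (with multiplicity). Let $p$ be a positive integer. Then the spectrum of the adjacency matrix of $S_p(\Gamma)$, as a multiset, is: if $\Gamma$ is balanced (in which case $\mu_n=0$): $0$ with multiplicity $pm-n+2$, together with $\pm\sqrt{p\mu_i}$ for $i=1,\dots,n-1$; if $\Gamma$ is unbalanced: $0$ with multiplicity $pm-n$, together with $\pm\sqrt{p\mu_i}$ for $i=1,\dots,n$.
   Context: A signed graph $\Gamma=(G,\sigma)$ is a simple graph $G$ with a sign function $\sigma:E(G)\to\{1,-1\}$; its adjacency matrix $A(\Gamma)$ has $(i,j)$ entry $\sigma(v_iv_j)$ if $v_iv_j\in E(G)$ and $0$ otherwise, and its Laplacian matrix is $L(\Gamma)=D(G)-A(\Gamma)$ with $D(G)$ the diagonal degree matrix. $\Gamma$ is balanced if every cycle has an even number of negative edges, unbalanced otherwise. The spectrum of a signed graph means the spectrum of its adjacency matrix. Orientation: for $\Gamma$ with vertices $v_1,\dots,v_n$ and edges $e_1,\dots,e_m$, fix a function $\vartheta$ assigning to each pair $(v,e)$ with $v$ an end of $e$ a value $\vartheta(v,e)\in\{1,-1\}$, such that for every edge $e=vw$, $\vartheta(v,e)\vartheta(w,e)=-\sigma(e)$. The signed graph $S_p(\Gamma)$ ($p$ a positive integer): its vertex set is $V(G)\cup\{e_j^{(t)}:1\le j\le m,\ 1\le t\le p\}$;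 its edges are exactly the pairs $v\,e_j^{(t)}$ with $v$ an end of $e_j$ in $G$, with sign $\vartheta(v,e_j)$ (the edges of $G$ are not kept). It has $n+pm$ vertices and $2pm$ edges; $S_1(\Gamma)=S(\Gamma)$ is the signed subdivision graph. -}

module Defs where

open import Level using (_⊔_) renaming (suc to lsuc)
open import Algebra.Bundles using (CommutativeRing)
open import Data.Nat.Base as ℕ using (ℕ)
open import Data.Nat.Divisibility using (_∣_)
open import Data.Fin.Base
  using (Fin; zero; suc; toℕ; fromℕ; inject₁; punchIn; _<_; _↑ˡ_; _↑ʳ_; remQuot; combine)
open import Data.Fin.Properties
  using (_≟_; any?; toℕ-↑ˡ; toℕ-↑ʳ; toℕ<n; ↑ˡ-injective; ↑ʳ-injective; combine-remQuot)
open import Data.Nat.Properties using (<-irrefl; m≤m+n; module ≤-Reasoning)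
open import Data.List.Base using (List; []; _∷_; length; filter; allFin; foldr)
open import Data.Product using (∃; _×_; _,_; proj₁; proj₂)
open import Data.Sum using (_⊎_; inj₁; inj₂)
open import Data.Sign.Base as Sign using (Sign)
import Data.Sign.Properties as Sign
open import Data.Vec.Functional using (Vector)
open import Function.Definitions using (Injective)
open import Relation.Binary.Core using (Rel)
open import Relation.Binary.Definitions using (Cotransitive)
open import Relation.Binary.Structures using (IsStrictPartialOrder)
open import Relation.Binary.Construct.Closure.ReflexiveTransitive using (Star)
open import Relation.Binary.PropositionalEquality
  using (_≡_; refl; sym; trans; cong; cong₂)
open import Relation.Nullary using (¬_; Dec; yes; no; contradiction)
open import Relation.Nullary.Decidable using (_×-dec_; _⊎-dec_)
open import Relation.Unary using (Decidable)

import Algebra.Definitions.RawMonoid as RawMonoidDefinitions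

-- The library has no real numbers.  Scalars range over an arbitrary
-- ordered field in which non-negative elements have square roots; ℝ is
-- one.  The axioms are the constructive ones: an order that is total in
-- the classical sense satisfies `compare` and `tight`, and so does the
-- order of the constructive reals.
record EuclideanField c ℓ₁ ℓ₂ : Set (lsuc (c ⊔ ℓ₁ ⊔ ℓ₂)) where
  infix 4 _<ᶠ_ _≤ᶠ_
  field
    commutativeRing : CommutativeRing c ℓ₁
  open CommutativeRing commutativeRing public
    hiding (refl; sym; trans) renaming (zero to *-zero)
  field
    _<ᶠ_                 : Rel Carrier ℓ₂
    isStrictPartialOrder : IsStrictPartialOrder _≈_ _<ᶠ_
    compare              : Cotransitive _<ᶠ_
    tight                : ∀ {x y} → ¬ (x <ᶠ y) → ¬ (y <ᶠ x) → x ≈ y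
    0<1                  : 0# <ᶠ 1#
    +-monoˡ-<            : ∀ {x y} z → x <ᶠ y → x + z <ᶠ y + z
    *-pos                : ∀ {x y} → 0# <ᶠ x → 0# <ᶠ y → 0# <ᶠ x * y
    -- Inverses of negative elements follow by negation.
    inverse              : ∀ {x} → 0# <ᶠ x → ∃ λ y → x * y ≈ 1#

  _≤ᶠ_ : Rel Carrier ℓ₂
  x ≤ᶠ y = ¬ (y <ᶠ x)

  -- The value of √ at negative arguments is unspecified.
  field
    √        : Carrier → Carrier
    √-nonneg : ∀ {x} → 0# ≤ᶠ x → 0# ≤ᶠ √ x
    √-square : ∀ {x} → 0# ≤ᶠ x → √ x * √ x ≈ x

-- Vertices are Fin n and edges are Fin m.  An edge, being a two-element
-- set of vertices, is stored as its increasing pair of ends, so that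
-- loops are excluded by `end₁<end₂` and multiple edges by `simple`.
record SignedGraph (n m : ℕ) : Set where
  field
    end₁ end₂ : Fin m → Fin n
    end₁<end₂ : ∀ e → end₁ e < end₂ e
    simple    : ∀ {e f} → end₁ e ≡ end₁ f → end₂ e ≡ end₂ f → e ≡ f
    σ         : Fin m → Sign

  Joins : Fin m → Fin n → Fin n → Set
  Joins e u v = (end₁ e ≡ u × end₂ e ≡ v) ⊎ (end₁ e ≡ v × end₂ e ≡ u)

  Joins? : ∀ u v → Decidable (λ e → Joins e u v)
  Joins? u v e = ((end₁ e ≟ u) ×-dec (end₂ e ≟ v))
           ⊎-dec ((end₁ e ≟ v) ×-dec (end₂ e ≟ u))

  Adjacent : Rel (Fin n) _
  Adjacent u v = ∃ λ e → Joins e u v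

  adjacent? : ∀ u v → Dec (Adjacent u v)
  adjacent? u v = any? (Joins? u v)

  Incident : Fin n → Fin m → Set
  Incident v e = (end₁ e ≡ v) ⊎ (end₂ e ≡ v)

  incident? : ∀ v → Decidable (Incident v)
  incident? v e = (end₁ e ≟ v) ⊎-dec (end₂ e ≟ v)

  degree : Fin n → ℕ
  degree v = length (filter (incident? v) (allFin m))

  Connected : Set
  Connected = ∀ u v → Star Adjacent u v

  -- A cycle v₀ v₁ … vₗ₊₂ v₀ with at least three vertices, all distinct;
  -- `edge i` is the edge leaving `vertex i`.
  record Cycle : Set where
    field
      l        : ℕ
      vertex   : Fin (3 ℕ.+ l) → Fin n
      edge     : Fin (3 ℕ.+ l) → Fin m
      distinct : Injective _≡_ _≡_ vertex
      step     : ∀ (i : Fin (2 ℕ.+ l)) →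
                 Joins (edge (inject₁ i)) (vertex (inject₁ i)) (vertex (suc i))
      close    : Joins (edge (fromℕ (2 ℕ.+ l))) (vertex (fromℕ (2 ℕ.+ l))) (vertex zero)

    negativeEdges : ℕ
    negativeEdges =
      length (filter (λ i → σ (edge i) Sign.≟ Sign.-) (allFin (3 ℕ.+ l)))

  Balanced : Set
  Balanced = ∀ (C : Cycle) → 2 ∣ Cycle.negativeEdges C

  -- Only the values ϑ v e with v an end of e are ever used.
  record Orientation : Set where
    field
      ϑ        : Fin n → Fin m → Sign
      oriented : ∀ e → ϑ (end₁ e) e Sign.* ϑ (end₂ e) e ≡ Sign.opposite (σ e)

-- The vertex v of Γ is v ↑ˡ (p * m), and the vertex e_j^(t) is
-- n ↑ʳ combine t j.  The index set Fin (2 * (p * m)) of the edges of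
-- S_p(Γ) encodes triples (b , t , j): the edge joining the b-th end of
-- e_j to e_j^(t).
module _ {n m : ℕ} (Γ : SignedGraph n m) (o : SignedGraph.Orientation Γ) (p : ℕ) where
  open SignedGraph Γ
  open Orientation o

  end : Fin 2 → Fin m → Fin n
  end zero       = end₁
  end (suc zero) = end₂

  ends-differ : ∀ e → ¬ (end₁ e ≡ end₂ e)
  ends-differ e eq = <-irrefl (cong toℕ eq) (end₁<end₂ e)

  end-injective : ∀ b b′ e → end b e ≡ end b′ e → b ≡ b′
  end-injective zero       zero       e eq = refl
  end-injective zero       (suc zero) e eq = contradiction eq (ends-differ e)
  end-injective (suc zero) zero       e eq = contradiction (sym eq) (ends-differ e)
  end-injective (suc zero) (suc zero) e eq = refl

  which : Fin (2 ℕ.* (p ℕ.* m)) → Fin 2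
  which x = proj₁ (remQuot {2} (p ℕ.* m) x)

  copy : Fin (2 ℕ.* (p ℕ.* m)) → Fin (p ℕ.* m)
  copy x = proj₂ (remQuot {2} (p ℕ.* m) x)

  edgeOf : Fin (p ℕ.* m) → Fin m
  edgeOf q = proj₂ (remQuot {p} m q)

  lower : Fin (2 ℕ.* (p ℕ.* m)) → Fin n
  lower x = end (which x) (edgeOf (copy x))

  ↑ˡ<↑ʳ : ∀ (v : Fin n) (q : Fin (p ℕ.* m)) → v ↑ˡ (p ℕ.* m) < n ↑ʳ q
  ↑ˡ<↑ʳ v q = begin-strict
    toℕ (v ↑ˡ (p ℕ.* m)) ≡⟨ toℕ-↑ˡ v (p ℕ.* m) ⟩
    toℕ v                <⟨ toℕ<n v ⟩
    n                    ≤⟨ m≤m+n n (toℕ q) ⟩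
    n ℕ.+ toℕ q          ≡⟨ toℕ-↑ʳ n q ⟨
    toℕ (n ↑ʳ q)         ∎
    where open ≤-Reasoning

  lower-copy-injective : ∀ {x y} → lower x ≡ lower y → copy x ≡ copy y → x ≡ y
  lower-copy-injective {x} {y} lo≡ c≡ =
    trans (sym (combine-remQuot {2} (p ℕ.* m) x))
      (trans (cong₂ combine w≡ c≡) (combine-remQuot {2} (p ℕ.* m) y))
    where
    w≡ : which x ≡ which y
    w≡ = end-injective (which x) (which y) (edgeOf (copy x))
           (trans lo≡ (cong (λ q → end (which y) (edgeOf q)) (sym c≡)))

  S : SignedGraph (n ℕ.+ p ℕ.* m) (2 ℕ.* (p ℕ.* m))
  S = record
    { end₁      = λ x → lower x ↑ˡ (p ℕ.* m)
    ; end₂      = λ x → n ↑ʳ copy x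
    ; end₁<end₂ = λ x → ↑ˡ<↑ʳ (lower x) (copy x)
    ; simple    = λ {x} {y} eq₁ eq₂ →
        lower-copy-injective (↑ˡ-injective (p ℕ.* m) (lower x) (lower y) eq₁)
                             (↑ʳ-injective n (copy x) (copy y) eq₂)
    ; σ         = λ x → ϑ (lower x) (edgeOf (copy x))
    }

module Spectral {c ℓ₁ ℓ₂} (K : EuclideanField c ℓ₁ ℓ₂) where
  open EuclideanField K
  open RawMonoidDefinitions +-rawMonoid public using (sum) renaming (_×_ to _·_)

  Matrix : ℕ → Set c
  Matrix n = Vector (Vector Carrier n) n

  identity : ∀ {n} → Matrix n
  identity i j with i ≟ j
  ... | yes _ = 1#
  ... | no  _ = 0#

  alternate : ℕ → Carrier → Carrier
  alternate ℕ.zero    x = x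
  alternate (ℕ.suc k) x = - alternate k x

  -- Laplace expansion along the first row.
  det : ∀ {n} → Matrix n → Carrier
  det {ℕ.zero}  M = 1#
  det {ℕ.suc n} M = sum λ j →
    alternate (toℕ j) (M zero j * det (λ i k → M (suc i) (punchIn j k)))

  charPoly : ∀ {n} → Matrix n → Carrier → Carrier
  charPoly M x = det λ i j → x * identity i j - M i j

  -- The list is the multiset of roots, with multiplicity, of the
  -- characteristic polynomial: det (x I - M) = ∏ (x - λᵢ).  An ordered
  -- field is infinite, so a polynomial is determined by its values.
  HasSpectrum : ∀ {n} → Matrix n → List Carrier → Set (c ⊔ ℓ₁)
  HasSpectrum M λs = ∀ x → charPoly M x ≈ foldr (λ l y → (x - l) * y) 1# λs

  ⟦_⟧ : Sign → Carrier
  ⟦ Sign.+ ⟧ = 1#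
  ⟦ Sign.- ⟧ = - 1#

  module _ {n m : ℕ} (Γ : SignedGraph n m) where
    open SignedGraph Γ

    adjacency : Matrix n
    adjacency u v with adjacent? u v
    ... | yes (e , _) = ⟦ σ e ⟧
    ... | no  _       = 0#

    laplacian : Matrix n
    laplacian u v = (degree u · 1#) * identity u v - adjacency u v

  ±√ : Carrier → List Carrier
  ±√ x = √ x ∷ - √ x ∷ []

{-# OPTIONS --safe #-}
module Submission where

open import Algebra.Bundles using (CommutativeRing)
import Algebra.Properties.CommutativeSemigroup as CommutativeSemigroupProperties
import Algebra.Properties.Ring as RingProperties
import Algebra.Properties.Semiring.Exp as Exp
import Algebra.Properties.Semiring.Mult as Mult
import Algebra.Properties.Semiring.Sum as Sum
open import Data.Fin.Base as Fin
  using (Fin; zero; suc; toℕ; fromℕ; inject₁; punchIn; punchOut; splitAt; remQuot; combine; _≤_; _↑ˡ_; _↑ʳ_)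
open import Data.Fin.Properties
  using (_≟_; any?; suc-injective; toℕ-↑ˡ; ↑ˡ-injective; ↑ʳ-injective; splitAt-↑ˡ; splitAt-↑ʳ;
         remQuot-combine; ≤fromℕ; <-asym; <-irrefl; punchInᵢ≢i; punchOut-cong; punchOut-punchIn)
open import Data.Fin.Subset using (Subset; ⊤; inside; outside)
open import Data.List.Base as List
  using (List; []; _∷_; _++_; length; filter; replicate; tabulate; concatMap; allFin)
open import Data.Nat.Base as ℕ using (ℕ; zero; suc; NonZero; z≤n; s≤s; _∸_; _⊔_)
open import Data.Nat.Divisibility using (_∣_; divides)
import Data.Nat.Properties as ℕ
open import Data.Product using (∃; _×_; _,_; proj₁; proj₂)
open import Data.Sign.Base as Sign using (Sign)
import Data.Sign.Properties as Sign
open import Data.Sum.Base using (_⊎_; inj₁; inj₂)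
import Data.Unit.Base as Unit
open import Data.Vec.Base using ([]; _∷_; insertAt)
open import Data.Vec.Functional as Vector using (Vector; head; tail)
open import Data.Vec.Functional.Properties using (lookup-++ˡ; lookup-++ʳ)
open import Defs
open import Function.Base using (_∘_; id)
open import Function.Definitions using (Injective; StrictlySurjective)
open import Relation.Binary.Construct.Closure.ReflexiveTransitive using (Star; ε; _◅_)
open import Relation.Binary.PropositionalEquality as ≡ using (_≡_; _≢_)
import Relation.Binary.Reasoning.Setoid as SetoidReasoning
open import Relation.Binary.Structures using (IsStrictPartialOrder)
open import Relation.Nullary using (¬_; yes; no; contradiction)
open import Relation.Unary using (Decidable)

-- Let B be the n × pm incidence matrix of S_p(Γ).  Its adjacency matrix is
-- A = (0 B; Bᵀ 0), and row operations on xI - A give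
-- xⁿ det (xI - A) = xᵖᵐ det (x²I - BBᵀ), where BBᵀ = p L(Γ).  Hence
-- xⁿ det (xI - A) = xᵖᵐ ∏ (x² - p μᵢ), and xⁿ may be cancelled because both
-- sides are polynomial functions.  A connected Γ has at least n - 1 edges, and
-- at least n unless some switching function s has σ(uv) = s(u) s(v), that is,
-- unless Γ is balanced; in that case sᵀ B = 0, so L(Γ) is singular and μₙ = 0.

-- Switching and balance

-- `det` is defined by expansion along the first row, a form in which row operations are invisible.
-- It is therefore identified with the top coefficient of the exterior product of the rows, where
-- these operations become multilinearity and alternation. The field is constructive: neither
-- equality nor order is assumed decidable, so no step splits on x = 0. Hence the upper rows are
-- multiplied by x instead of dividing the lower ones by it, and the surplus factor is cancelled
-- between functions in Horner form, not point by point. The spectrum of L(Γ) is known only as a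
-- factorisation of the values of its characteristic polynomial. No eigenvector is extracted from
-- it, and the factor p is absorbed by evaluating the factorisation at x²/p. The edge counts are
-- what makes the truncated differences pm ∸ n and pm + 2 ∸ n genuine multiplicities. Count and
-- switching function come out of a single computation, the merging of components edge by edge: it
-- returns n ≤ m or a switching function, so balance never has to be decided.

module _ where
  open ≡ using (refl; sym; trans; cong; cong₂; subst; subst₂; module ≡-Reasoning)
  open import Data.Sign.Base using (opposite; _*_)

  signProduct : ∀ {k} → Vector Sign k → Sign
  signProduct = Vector.foldr _*_ Sign.+

  negativePower : ℕ → Sign
  negativePower zero    = Sign.+
  negativePower (suc k) = opposite (negativePower k)

  -- The map `f` is general for the induction: `allFin` is `tabulate id`, and its tail is already a
  -- `tabulate` of `suc`.
  signProduct-negatives : ∀ {A : Set} {k} (τ : A → Sign) (f : Fin k → A) →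
    negativePower (length (filter (λ a → τ a Sign.≟ Sign.-) (tabulate f))) ≡ signProduct (τ ∘ f)
  signProduct-negatives {k = zero}  τ f = refl
  signProduct-negatives {k = suc k} τ f with τ (f zero)
  ... | Sign.+ = signProduct-negatives τ (f ∘ suc)
  ... | Sign.- = cong opposite (signProduct-negatives τ (f ∘ suc))

  even⇒negativePower≡+ : ∀ {k} → 2 ∣ k → negativePower k ≡ Sign.+
  even⇒negativePower≡+ (divides q refl) = go q
    where
    go : ∀ q → negativePower (q ℕ.* 2) ≡ Sign.+
    go zero    = refl
    go (suc q) = trans (Sign.opposite-involutive _) (go q)

  negativePower≡+⇒even : ∀ k → negativePower k ≡ Sign.+ → 2 ∣ k
  negativePower≡+⇒even zero          eq = divides 0 refl
  negativePower≡+⇒even (suc (suc k)) eq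
    with divides q refl ← negativePower≡+⇒even k (trans (sym (Sign.opposite-involutive _)) eq) =
    divides (suc q) refl

  signProduct-last : ∀ {k} (τ : Vector Sign (suc k)) →
                     signProduct τ ≡ signProduct (τ ∘ inject₁) * τ (fromℕ k)
  signProduct-last {zero}  τ = Sign.*-identityʳ _
  signProduct-last {suc k} τ =
    trans (cong (τ zero *_) (signProduct-last (tail τ))) (sym (Sign.*-assoc (τ zero) _ _))

  signProduct-cong : ∀ {k} {τ υ : Vector Sign k} → (∀ i → τ i ≡ υ i) → signProduct τ ≡ signProduct υ
  signProduct-cong {zero}  τ≡υ = refl
  signProduct-cong {suc k} τ≡υ = cong₂ _*_ (τ≡υ zero) (signProduct-cong (τ≡υ ∘ suc))

  *-insert : ∀ a b c → (a * b) * (b * c) ≡ a * c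
  *-insert Sign.+ Sign.+ c = refl
  *-insert Sign.+ Sign.- c = Sign.opposite-involutive c
  *-insert Sign.- Sign.+ c = refl
  *-insert Sign.- Sign.- c = refl

  *-common : ∀ c a b → (c * a) * (c * b) ≡ a * b
  *-common Sign.+ a      b = refl
  *-common Sign.- Sign.+ b = Sign.opposite-involutive b
  *-common Sign.- Sign.- b = refl

  -- Every inner value of `s` occurs in two neighbouring factors and squares to +.
  signProduct-telescope : ∀ {k} (s : Vector Sign (suc k)) →
                          signProduct (λ i → s (inject₁ i) * s (suc i)) ≡ s zero * s (fromℕ k)
  signProduct-telescope {zero}  s = sym (Sign.s*s≡+ (s zero))
  signProduct-telescope {suc k} s =
    trans (cong (s zero * s (suc zero) *_) (signProduct-telescope (tail s)))
          (*-insert (s zero) (s (suc zero)) _)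

  -- The quotient that identifies `i` with `j`: the label `i` is removed and its elements go to the
  -- place of `j`.
  collapse : ∀ {N} {i j : Fin (suc N)} → i ≢ j → Fin (suc N) → Fin N
  collapse {i = i} i≢j x with i ≟ x
  ... | yes _   = punchOut i≢j
  ... | no  i≢x = punchOut i≢x

  collapse-≡ : ∀ {N} {i j : Fin (suc N)} (i≢j : i ≢ j) → collapse i≢j i ≡ collapse i≢j j
  collapse-≡ {i = i} {j} i≢j with i ≟ i | i ≟ j
  ... | no i≢i | _       = contradiction refl i≢i
  ... | yes _  | yes i≡j = contradiction i≡j i≢j
  ... | yes _  | no _    = punchOut-cong i refl

  collapse-surjective : ∀ {N} {i j : Fin (suc N)} (i≢j : i ≢ j) → StrictlySurjective _≡_ (collapse i≢j)
  collapse-surjective {i = i} i≢j y = punchIn i y , lemma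
    where
    lemma : collapse i≢j (punchIn i y) ≡ y
    lemma with i ≟ punchIn i y
    ... | yes eq = contradiction (sym eq) (punchInᵢ≢i i y)
    ... | no _   = trans (punchOut-cong i refl) (punchOut-punchIn i)

  -- Each edge a e — b e either merges two labels or closes a cycle; in the
  -- latter case the bound becomes strict, and as long as only the former
  -- occurs the signs τ come from a switching function.
  record Components {n k : ℕ} (a b : Vector (Fin n) k) (τ : Vector Sign k) : Set where
    field
      N          : ℕ
      label      : Fin n → Fin N
      surjective : StrictlySurjective _≡_ label
      constant   : ∀ e → label (a e) ≡ label (b e)
      bound      : n ℕ.≤ N ℕ.+ k
      dichotomy  : n ℕ.< N ℕ.+ k ⊎ (∃ λ (s : Fin n → Sign) → ∀ e → τ e ≡ s (a e) * s (b e))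

  components : ∀ {n k} (a b : Vector (Fin n) k) (τ : Vector Sign k) → Components a b τ
  components {n} {zero} a b τ = record
    { label      = id
    ; surjective = λ y → y , refl
    ; constant   = λ ()
    ; bound      = ℕ.≤-reflexive (sym (ℕ.+-identityʳ n))
    ; dichotomy  = inj₂ ((λ _ → Sign.+) , λ ())
    }
  components {n} {suc k} a b τ = extend (components (tail a) (tail b) (tail τ))
    where
    u = head a
    v = head b

    extend : Components (tail a) (tail b) (tail τ) → Components a b τ
    extend record { N = zero ; label = label } with () ← label u
    extend record { N = suc N ; label = label ; surjective = surjective
                  ; constant = constant ; bound = bound ; dichotomy = dichotomy }
      with label v ≟ label u
    ... | yes v~u = record
      { label      = label
      ; surjective = surjective
      ; constant   = λ { zero → sym v~u ; (suc e) → constant e }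
      ; bound      = ℕ.≤-trans bound (ℕ.+-monoʳ-≤ (suc N) (ℕ.n≤1+n k))
      ; dichotomy  = inj₁ (ℕ.≤-trans (s≤s bound) (ℕ.≤-reflexive (sym (ℕ.+-suc (suc N) k))))
      }
    ... | no v≁u = record
      { label      = collapse v≁u ∘ label
      ; surjective = λ y → let z , z↦y = collapse-surjective v≁u y
                               x , x↦z = surjective z
                           in x , trans (cong (collapse v≁u) x↦z) z↦y
      ; constant   = λ { zero → sym (collapse-≡ v≁u) ; (suc e) → cong (collapse v≁u) (constant e) }
      ; bound      = subst (n ℕ.≤_) (sym (ℕ.+-suc N k)) bound
      ; dichotomy  = dichotomy′ dichotomy
      }
      where
      dichotomy′ : n ℕ.< suc N ℕ.+ k ⊎ (∃ λ s → ∀ e → tail τ e ≡ s (tail a e) * s (tail b e)) →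
                   n ℕ.< N ℕ.+ suc k ⊎ (∃ λ s → ∀ e → τ e ≡ s (a e) * s (b e))
      dichotomy′ (inj₁ n<) = inj₁ (subst (n ℕ.<_) (sym (ℕ.+-suc N k)) n<)
      dichotomy′ (inj₂ (s , s-ok)) = inj₂ (s′ , λ { zero → new ; (suc e) → old e })
        where
        -- Switch the component of v so that the new edge gets the sign τ zero.
        flip : Fin (suc N) → Sign
        flip i with label v ≟ i
        ... | yes _ = τ zero * (s u * s v)
        ... | no  _ = Sign.+

        s′ : Fin n → Sign
        s′ x = flip (label x) * s x

        -- Both ends of an earlier edge carry the same label, so their `flip` factors agree and
        -- cancel.
        old : ∀ e → τ (suc e) ≡ s′ (a (suc e)) * s′ (b (suc e))
        old e = trans (s-ok e) (trans (sym (*-common (flip (label (b (suc e)))) _ _))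
          (cong (λ i → flip i * s (a (suc e)) * s′ (b (suc e))) (sym (constant e))))

        flip-u : flip (label u) ≡ Sign.+
        flip-u with label v ≟ label u
        ... | yes v~u = contradiction v~u v≁u
        ... | no  _   = refl

        flip-v : flip (label v) ≡ τ zero * (s u * s v)
        flip-v with label v ≟ label v
        ... | yes _  = refl
        ... | no v≁v = contradiction refl v≁v

        -- With `flip` equal to + at `u` and to t(xy) at `v`, the factors x and y each occur twice
        -- and only t survives.
        solve : ∀ t x y → t ≡ (Sign.+ * x) * (t * (x * y) * y)
        solve Sign.+ Sign.+ Sign.+ = refl
        solve Sign.+ Sign.+ Sign.- = refl
        solve Sign.+ Sign.- Sign.+ = refl
        solve Sign.+ Sign.- Sign.- = refl
        solve Sign.- Sign.+ Sign.+ = refl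
        solve Sign.- Sign.+ Sign.- = refl
        solve Sign.- Sign.- Sign.+ = refl
        solve Sign.- Sign.- Sign.- = refl

        new : τ zero ≡ s′ u * s′ v
        new = trans (solve (τ zero) (s u) (s v))
          (cong₂ (λ x y → (x * s u) * (y * s v)) (sym flip-u) (sym flip-v))

  -- Switching functions of a signed graph

  module Graph {n m : ℕ} (Γ : SignedGraph n m) where
    open SignedGraph Γ

    Switching : (Fin n → Sign) → Set
    Switching s = ∀ e → σ e ≡ s (end₁ e) * s (end₂ e)

    Joins-sym : ∀ {e u v} → Joins e u v → Joins e v u
    Joins-sym (inj₁ (p , q)) = inj₂ (p , q)
    Joins-sym (inj₂ (p , q)) = inj₁ (p , q)

    Joins-irrefl : ∀ {e u} → ¬ Joins e u u
    Joins-irrefl {e} (inj₁ (p , q)) = <-irrefl (trans p (sym q)) (end₁<end₂ e)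
    Joins-irrefl {e} (inj₂ (p , q)) = <-irrefl (trans p (sym q)) (end₁<end₂ e)

    Joins-unique : ∀ {e f u v} → Joins e u v → Joins f u v → e ≡ f
    Joins-unique (inj₁ (refl , refl)) (inj₁ (r , s)) = simple (sym r) (sym s)
    Joins-unique (inj₂ (refl , refl)) (inj₂ (r , s)) = simple (sym r) (sym s)
    Joins-unique {e} {f} (inj₁ (refl , refl)) (inj₂ (r , s)) =
      contradiction (end₁<end₂ e) (<-asym (subst₂ Fin._<_ r s (end₁<end₂ f)))
    Joins-unique {e} {f} (inj₂ (refl , refl)) (inj₁ (r , s)) =
      contradiction (end₁<end₂ e) (<-asym (subst₂ Fin._<_ r s (end₁<end₂ f)))

    Joins-switching : ∀ s → Switching s → ∀ {e u v} → Joins e u v → σ e ≡ s u * s v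
    Joins-switching s sw {e} (inj₁ (refl , refl)) = sw e
    Joins-switching s sw {e} (inj₂ (refl , refl)) = trans (sw e) (Sign.*-comm (s (end₁ e)) _)

    connected⇒constant : Connected → ∀ {A : Set} (f : Fin n → A) →
                         (∀ e → f (end₁ e) ≡ f (end₂ e)) → ∀ u v → f u ≡ f v
    connected⇒constant connected f f-edge u v = along (connected u v)
      where
      along : ∀ {u v} → Star Adjacent u v → f u ≡ f v
      along ε = refl
      along ((e , inj₁ (refl , refl)) ◅ path) = trans (f-edge e) (along path)
      along ((e , inj₂ (refl , refl)) ◅ path) = trans (sym (f-edge e)) (along path)

    module _ (connected : Connected) where
      open Components (components end₁ end₂ σ)

      -- A labelling constant along edges is constant on a connected graph, and a surjective one
      -- then has no room for a second label. The inequality also covers n = 0.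
      oneLabel : N ℕ.≤ 1
      oneLabel = helper label surjective (connected⇒constant connected label constant)
        where
        helper : ∀ {N} (f : Fin n → Fin N) → StrictlySurjective _≡_ f → (∀ u v → f u ≡ f v) → N ℕ.≤ 1
        helper {zero}        f surj const = z≤n
        helper {suc zero}    f surj const = s≤s z≤n
        helper {suc (suc N)} f surj const
          with x , fx≡0 ← surj zero | y , fy≡1 ← surj (suc zero)
          with () ← trans (sym fx≡0) (trans (const x y) fy≡1)

      connected⇒n≤1+m : n ℕ.≤ suc m
      connected⇒n≤1+m = ℕ.≤-trans bound (ℕ.+-monoˡ-≤ m oneLabel)

      -- With at most one component left, the strict bound n < N + m becomes n ≤ m. The other
      -- alternative is a switching function for all edges.
      n≤m⊎switching : n ℕ.≤ m ⊎ ∃ Switching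
      n≤m⊎switching with dichotomy
      ... | inj₁ n<  = inj₁ (ℕ.≤-pred (ℕ.≤-trans n< (ℕ.+-monoˡ-≤ m oneLabel)))
      ... | inj₂ s = inj₂ s

    -- Around a cycle each s(v) occurs twice, once for each of the two edges of the cycle at v, so
    -- the product of the edge signs is +.
    switching⇒balanced : ∀ s → Switching s → Balanced
    switching⇒balanced s sw C = negativePower≡+⇒even _ (begin
      negativePower (Cycle.negativeEdges C)
        ≡⟨ signProduct-negatives (σ ∘ edge) id ⟩
      signProduct (σ ∘ edge)
        ≡⟨ signProduct-last (σ ∘ edge) ⟩
      signProduct (σ ∘ edge ∘ inject₁) * σ (edge (fromℕ (2 ℕ.+ l)))
        ≡⟨ cong₂ _*_ (trans (signProduct-cong λ i → Joins-switching s sw (step i))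
                            (signProduct-telescope (s ∘ vertex)))
                     (Joins-switching s sw close) ⟩
      (s (vertex zero) * s (vertex (fromℕ (2 ℕ.+ l)))) * (s (vertex (fromℕ (2 ℕ.+ l))) * s (vertex zero))
        ≡⟨ *-insert (s (vertex zero)) (s (vertex (fromℕ (2 ℕ.+ l)))) (s (vertex zero)) ⟩
      s (vertex zero) * s (vertex zero)
        ≡⟨ Sign.s*s≡+ (s (vertex zero)) ⟩
      Sign.+ ∎)
      where
      open Cycle C
      open ≡-Reasoning

    -- Walks, paths and the switching function of a balanced graph

    infixr 5 _∷_ _⧺_

    data Walk : ℕ → Fin n → Fin n → Set where
      []  : ∀ {u} → Walk 0 u u
      _∷_ : ∀ {k u v w} → (∃ λ e → Joins e u v) → Walk k v w → Walk (suc k) u w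

    sign : ∀ {k u v} → Walk k u v → Sign
    sign []            = Sign.+
    sign ((e , _) ∷ W) = σ e * sign W

    vertices : ∀ {k u v} → Walk k u v → Fin (suc k) → Fin n
    vertices {u = u} W       zero    = u
    vertices         (_ ∷ W) (suc i) = vertices W i

    _⧺_ : ∀ {j k u v w} → Walk j u v → Walk k v w → Walk (j ℕ.+ k) u w
    []      ⧺ X = X
    (e ∷ W) ⧺ X = e ∷ (W ⧺ X)

    sign-⧺ : ∀ {j k u v w} (W : Walk j u v) (X : Walk k v w) → sign (W ⧺ X) ≡ sign W * sign X
    sign-⧺ []            X = refl
    sign-⧺ ((e , _) ∷ W) X = trans (cong (σ e *_) (sign-⧺ W X)) (sym (Sign.*-assoc (σ e) _ _))

    vertices-last : ∀ {k u v} (W : Walk k u v) → vertices W (fromℕ k) ≡ v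
    vertices-last []      = refl
    vertices-last (_ ∷ W) = vertices-last W

    Path : ∀ {k u v} → Walk k u v → Set
    Path []              = Unit.⊤
    Path (_∷_ {u = u} _ W) = (∀ i → vertices W i ≢ u) × Path W

    path⇒injective : ∀ {k u v} (W : Walk k u v) → Path W → Injective _≡_ _≡_ (vertices W)
    path⇒injective W       path             {zero}  {zero}  eq = refl
    path⇒injective (_ ∷ W) (u∉W , path)     {zero}  {suc j} eq = contradiction (sym eq) (u∉W j)
    path⇒injective (_ ∷ W) (u∉W , path)     {suc i} {zero}  eq = contradiction eq (u∉W i)
    path⇒injective (_ ∷ W) (u∉W , path)     {suc i} {suc j} eq = cong suc (path⇒injective W path eq)

    -- A path never revisits its first vertex, so a closed one is empty.
    closedPath-sign : ∀ {k u} (W : Walk k u u) → Path W → sign W ≡ Sign.+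
    closedPath-sign []      path         = refl
    closedPath-sign (_ ∷ W) (u∉W , path) = contradiction (vertices-last W) (u∉W (fromℕ _))

    -- Cutting a path at one of its vertices. The field `front⊆` is what lets the induction see that
    -- the front part is again a path.
    record Split {k u v} (W : Walk k u v) (x : Fin n) : Set where
      field
        {a b}       : ℕ
        front       : Walk a u x
        back        : Walk b x v
        front-path  : Path front
        back-path   : Path back
        front⊆      : ∀ i → ∃ λ j → vertices front i ≡ vertices W j
        sign-split  : sign W ≡ sign front * sign back

    split : ∀ {k u v} (W : Walk k u v) → Path W → ∀ i → Split W (vertices W i)
    split W path zero = record
      { front      = []
      ; back       = W
      ; front-path = Unit.tt
      ; back-path  = path
      ; front⊆     = λ { zero → zero , refl }
      ; sign-split = refl
      }
    split (e ∷ W) (u∉W , path) (suc i) = record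
      { front      = e ∷ front
      ; back       = back
      ; front-path = (λ j eq → let j′ , eq′ = front⊆ j in u∉W j′ (trans (sym eq′) eq)) , front-path
      ; back-path  = back-path
      ; front⊆     = λ { zero → zero , refl ; (suc j) → let j′ , eq′ = front⊆ j in suc j′ , eq′ }
      ; sign-split = trans (cong (σ (proj₁ e) *_) sign-split) (sym (Sign.*-assoc (σ (proj₁ e)) _ _))
      }
      where open Split (split W path i)

    -- The edges of the walk followed by one closing edge, indexed like the vertices, which is the
    -- form of the field `edge` of a `Cycle`.
    edgesThen : ∀ {k u v} → Walk k u v → Fin m → Fin (suc k) → Fin m
    edgesThen []            e _       = e
    edgesThen ((f , _) ∷ W) e zero    = f
    edgesThen (_       ∷ W) e (suc i) = edgesThen W e i

    edgesThen-step : ∀ {k u v} (W : Walk k u v) e i →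
      Joins (edgesThen W e (inject₁ i)) (vertices W (inject₁ i)) (vertices W (suc i))
    edgesThen-step ((_ , joins) ∷ []) e zero = joins
    edgesThen-step ((_ , joins) ∷ _ ∷ _) e zero = joins
    edgesThen-step (_ ∷ W) e (suc i) = edgesThen-step W e i

    edgesThen-last : ∀ {k u v} (W : Walk k u v) e → edgesThen W e (fromℕ k) ≡ e
    edgesThen-last []      e = refl
    edgesThen-last (_ ∷ W) e = edgesThen-last W e

    edgesThen-sign : ∀ {k u v} (W : Walk k u v) e → signProduct (σ ∘ edgesThen W e) ≡ sign W * σ e
    edgesThen-sign []            e = Sign.*-identityʳ _
    edgesThen-sign ((f , _) ∷ W) e =
      trans (cong (σ f *_) (edgesThen-sign W e)) (sym (Sign.*-assoc (σ f) _ _))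

    module _ (balanced : Balanced) where

      -- A `Cycle` has at least three vertices, so short paths are treated apart: length 0 would
      -- make `e` a loop, and at length 1 the single edge is `e` itself because the graph is simple,
      -- giving σ(e)² = +. From length 2 on, closing the path with `e` gives a cycle.
      closing-sign : ∀ {k u w e} → Joins e u w → (W : Walk k w u) → Path W → σ e * sign W ≡ Sign.+
      closing-sign joins [] path = contradiction joins Joins-irrefl
      closing-sign {e = e} joins ((f , joins′) ∷ []) path
        with refl ← Joins-unique joins (Joins-sym joins′) =
        trans (cong (σ e *_) (Sign.*-identityʳ _)) (Sign.s*s≡+ (σ e))
      closing-sign {u = u} {e = e} joins W@(_∷_ {suc l} _ (_ ∷ _)) path = begin
        σ e * sign W                                ≡⟨ Sign.*-comm (σ e) _ ⟩
        sign W * σ e                                ≡⟨ edgesThen-sign W e ⟨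
        signProduct (σ ∘ edgesThen W e)             ≡⟨ signProduct-negatives (σ ∘ edgesThen W e) id ⟨
        negativePower (Cycle.negativeEdges cycle)   ≡⟨ even⇒negativePower≡+ (balanced cycle) ⟩
        Sign.+                                      ∎
        where
        open ≡-Reasoning
        cycle : Cycle
        cycle = record
          { l        = l
          ; vertex   = vertices W
          ; edge     = edgesThen W e
          ; distinct = path⇒injective W path
          ; step     = edgesThen-step W e
          ; close    = subst₂ (λ f x → Joins f x _) (sym (edgesThen-last W e)) (sym (vertices-last W)) joins
          }

      -- Loop erasure, starting from the far end. If the new vertex `u` already lies on the path
      -- `P`, the edge `e` and the part of `P` up to `u` form a closed path with one closing edge.
      -- Its sign is + by balance, so dropping it keeps the sign.
      toPath : ∀ {k u v} (W : Walk k u v) → ∃ λ j → ∃ λ (P : Walk j u v) → Path P × sign P ≡ sign W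
      toPath [] = 0 , [] , Unit.tt , refl
      toPath {u = u} (step@(e , joins) ∷ W) with toPath W
      ... | j , P , path , sign≡ with any? (λ i → vertices P i ≟ u)
      ...   | no u∉P = suc j , step ∷ P , ((λ i eq → u∉P (i , eq)) , path) , cong (σ e *_) sign≡
      ...   | yes (i , refl) = _ , back , back-path , (begin
        sign back                          ≡⟨⟩
        Sign.+ * sign back                 ≡⟨ cong (_* sign back) (closing-sign joins front front-path) ⟨
        (σ e * sign front) * sign back     ≡⟨ Sign.*-assoc (σ e) _ _ ⟩
        σ e * (sign front * sign back)     ≡⟨ cong (σ e *_) (trans (sym sign-split) sign≡) ⟩
        σ e * sign W                       ∎)
        where
        open ≡-Reasoning
        open Split (split P path i)

      closed-sign : ∀ {k u} (W : Walk k u u) → sign W ≡ Sign.+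
      closed-sign W with _ , P , path , sign≡ ← toPath W = trans (sym sign≡) (closedPath-sign P path)

      -- The value s(v) is the sign of a chosen walk from the root to v. For an edge e, one return
      -- walk W from its second end closes both the chosen walk to that end and the chosen walk to
      -- the first end followed by e. Both closed walks have sign +.
      balanced⇒switching : Connected → Fin n → ∃ Switching
      balanced⇒switching connected root = s , switching
        where
        walk : ∀ {u v} → Star Adjacent u v → ∃ λ k → Walk k u v
        walk ε = 0 , []
        walk (step ◅ path) with k , W ← walk path = suc k , step ∷ W

        from : ∀ v → ∃ λ k → Walk k root v
        from v = walk (connected root v)

        s : Fin n → Sign
        s v = sign (proj₂ (from v))

        -- The first equation forces b = c, and the second then forces e = ab; only four sign
        -- patterns satisfy both.
        cancel : ∀ a e b c → b * c ≡ Sign.+ → a * (e * c) ≡ Sign.+ → e ≡ a * b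
        cancel Sign.+ Sign.+ Sign.+ Sign.+ p q = refl
        cancel Sign.+ Sign.- Sign.- Sign.- p q = refl
        cancel Sign.- Sign.- Sign.+ Sign.+ p q = refl
        cancel Sign.- Sign.+ Sign.- Sign.- p q = refl

        switching : Switching s
        switching e with _ , W ← walk (connected (end₂ e) root) =
          cancel (s (end₁ e)) (σ e) (s (end₂ e)) (sign W)
            (trans (sym (sign-⧺ W₂ W)) (closed-sign (W₂ ⧺ W)))
            (trans (sym (sign-⧺ W₁ (step ∷ W))) (closed-sign (W₁ ⧺ step ∷ W)))
          where
          W₁ = proj₂ (from (end₁ e))
          W₂ = proj₂ (from (end₂ e))
          step = e , inj₁ (refl , refl)

-- Determinants

punchIn-↑ˡ : ∀ {n q} (j : Fin (suc n)) (k : Fin n) → punchIn (j ↑ˡ q) (k ↑ˡ q) ≡ punchIn j k ↑ˡ q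
punchIn-↑ˡ zero    k       = ≡.refl
punchIn-↑ˡ (suc j) zero    = ≡.refl
punchIn-↑ˡ (suc j) (suc k) = ≡.cong suc (punchIn-↑ˡ j k)

punchIn-↑ʳ : ∀ {n q} (j : Fin (suc n)) (k : Fin q) → punchIn (j ↑ˡ q) (n ↑ʳ k) ≡ suc n ↑ʳ k
punchIn-↑ʳ         zero    k = ≡.refl
punchIn-↑ʳ {suc n} (suc j) k = ≡.cong suc (punchIn-↑ʳ j k)

↑ˡ≢↑ʳ : ∀ {n q} (i : Fin n) (j : Fin q) → ¬ (i ↑ˡ q ≡ n ↑ʳ j)
↑ˡ≢↑ʳ {n} {q} i j eq
  with () ← ≡.trans (≡.sym (splitAt-↑ˡ n i q)) (≡.trans (≡.cong (splitAt n) eq) (splitAt-↑ʳ n q j))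

module FieldProperties {c ℓ₁ ℓ₂} (K : EuclideanField c ℓ₁ ℓ₂) where
  open EuclideanField K
  open CommutativeRing commutativeRing using (refl; sym; trans)
  open Spectral K
  open RingProperties ring
  open Exp semiring using (_^_; ^-homo-*)
  open Mult semiring using (×-assoc-*; ×-congʳ)
  open Sum semiring
    using (sum-cong-≋; ∑-distrib-+; ∑-comm; *-distribˡ-sum; *-distribʳ-sum; sum-replicate-zero)
  open SetoidReasoning setoid
  private
    module + = CommutativeSemigroupProperties +-commutativeSemigroup
    module * = CommutativeSemigroupProperties *-commutativeSemigroup

  minus-zero : ∀ {x y} → y ≈ 0# → x - y ≈ x
  minus-zero y≈0 = trans (+-congˡ (trans (-‿cong y≈0) -0#≈0#)) (+-identityʳ _)

  sum-zero : ∀ {n} {t : Vector Carrier n} → (∀ i → t i ≈ 0#) → sum t ≈ 0#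
  sum-zero {n} t≈0 = trans (sum-cong-≋ t≈0) (sum-replicate-zero n)

  sum-neg : ∀ {n} (t : Vector Carrier n) → sum (λ i → - t i) ≈ - sum t
  sum-neg {zero}  t = sym -0#≈0#
  sum-neg {suc n} t = trans (+-congˡ (sum-neg (tail t))) (-‿+-comm _ _)

  sum-++ : ∀ m {n} (t : Vector Carrier (m ℕ.+ n)) →
           sum t ≈ sum (λ i → t (i ↑ˡ n)) + sum (λ j → t (m ↑ʳ j))
  sum-++ zero    t = sym (+-identityˡ _)
  sum-++ (suc m) t = trans (+-congˡ (sum-++ m (tail t))) (sym (+-assoc _ _ _))

  sum-isolate : ∀ {n} (i : Fin n) {t : Vector Carrier n} →
                (∀ j → ¬ (j ≡ i) → t j ≈ 0#) → sum t ≈ t i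
  sum-isolate zero    t≈0 =
    trans (+-congˡ (sum-zero λ j → t≈0 (suc j) λ ())) (+-identityʳ _)
  sum-isolate (suc i) t≈0 =
    trans (+-cong (t≈0 zero λ ())
                  (sum-isolate i λ j j≢i → t≈0 (suc j) (j≢i ∘ suc-injective)))
          (+-identityˡ _)

  alternate-cong : ∀ k {x y} → x ≈ y → alternate k x ≈ alternate k y
  alternate-cong zero    x≈y = x≈y
  alternate-cong (suc k) x≈y = -‿cong (alternate-cong k x≈y)

  alternate-*ʳ : ∀ k x y → alternate k (x * y) ≈ alternate k x * y
  alternate-*ʳ zero    x y = refl
  alternate-*ʳ (suc k) x y = trans (-‿cong (alternate-*ʳ k x y)) (-‿distribˡ-* _ _)

  alternate-zero : ∀ k {x} → x ≈ 0# → alternate k x ≈ 0#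
  alternate-zero zero    x≈0 = x≈0
  alternate-zero (suc k) x≈0 = trans (-‿cong (alternate-zero k x≈0)) -0#≈0#

  det-cong : ∀ {n} {M N : Matrix n} → (∀ i j → M i j ≈ N i j) → det M ≈ det N
  det-cong {zero}  M≈N = refl
  det-cong {suc n} M≈N = sum-cong-≋ λ j → alternate-cong (toℕ j)
    (*-cong (M≈N zero j) (det-cong λ i k → M≈N (suc i) (punchIn j k)))

  -- Exterior algebra

  -- An element of the exterior algebra on n generators, as the family of
  -- its coefficients in the basis indexed by sets of generators.
  Form : ℕ → Set c
  Form n = Subset n → Carrier

  infix  4 _≈ᶠ_
  infixr 6 _∧_

  _≈ᶠ_ : ∀ {n} → Form n → Form n → Set _
  f ≈ᶠ g = ∀ S → f S ≈ g S

  -- The recursion splits off the first generator e: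
  -- (r₀ e + r′) ∧ (α + e ∧ β) = r′ ∧ α + e ∧ (r₀ α - r′ ∧ β).
  _∧_ : ∀ {n} → Vector Carrier n → Form n → Form n
  (r ∧ f) []            = 0#
  (r ∧ f) (outside ∷ S) = (tail r ∧ (f ∘ (outside ∷_))) S
  (r ∧ f) (inside  ∷ S) = head r * f (outside ∷ S) - (tail r ∧ (f ∘ (inside ∷_))) S

  ∧-cong : ∀ {n} {r s : Vector Carrier n} {f g} → (∀ i → r i ≈ s i) → f ≈ᶠ g → r ∧ f ≈ᶠ s ∧ g
  ∧-cong r≈s f≈g []            = refl
  ∧-cong r≈s f≈g (outside ∷ S) = ∧-cong (r≈s ∘ suc) (f≈g ∘ (outside ∷_)) S
  ∧-cong r≈s f≈g (inside  ∷ S) = +-cong (*-cong (r≈s zero) (f≈g _))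
    (-‿cong (∧-cong (r≈s ∘ suc) (f≈g ∘ (inside ∷_)) S))

  ∧-congʳ : ∀ {n} (r : Vector Carrier n) {f g} → f ≈ᶠ g → r ∧ f ≈ᶠ r ∧ g
  ∧-congʳ r = ∧-cong {r = r} λ _ → refl

  -- The shape a r + s is that of a row operation: a scaled row plus a correction.
  ∧-linearˡ : ∀ {n} a (r s : Vector Carrier n) f →
              (λ i → a * r i + s i) ∧ f ≈ᶠ λ S → a * (r ∧ f) S + (s ∧ f) S
  ∧-linearˡ a r s f [] = sym (trans (+-identityʳ _) (zeroʳ a))
  ∧-linearˡ a r s f (outside ∷ S) = ∧-linearˡ a (tail r) (tail s) (f ∘ (outside ∷_)) S
  ∧-linearˡ a r s f (inside ∷ S) = begin
    (a * head r + head s) * y - ((λ i → a * r (suc i) + s (suc i)) ∧ g) S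
      ≈⟨ +-cong (distribʳ _ _ _) (-‿cong (∧-linearˡ a (tail r) (tail s) g S)) ⟩
    (a * head r * y + head s * y) - (a * R + P)
      ≈⟨ +-cong (+-congʳ (*-assoc _ _ _)) (sym (-‿+-comm _ _)) ⟩
    (a * (head r * y) + head s * y) + (- (a * R) - P)
      ≈⟨ +.interchange _ _ _ _ ⟩
    (a * (head r * y) - a * R) + (head s * y - P)
      ≈⟨ +-congʳ (x[y-z]≈xy-xz _ _ _) ⟨
    a * (head r * y - R) + (head s * y - P) ∎
    where
    y = f (outside ∷ S)
    g = f ∘ (inside ∷_)
    R = (tail r ∧ g) S
    P = (tail s ∧ g) S

  -- The shape a f - g is that of the `inside` coefficients of a product, which is what two nested
  -- products require.
  ∧-linearʳ : ∀ {n} a (r : Vector Carrier n) f g →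
              r ∧ (λ S → a * f S - g S) ≈ᶠ λ S → a * (r ∧ f) S - (r ∧ g) S
  ∧-linearʳ a r f g [] = sym (trans (+-cong (zeroʳ a) -0#≈0#) (+-identityʳ _))
  ∧-linearʳ a r f g (outside ∷ S) = ∧-linearʳ a (tail r) (f ∘ (outside ∷_)) (g ∘ (outside ∷_)) S
  ∧-linearʳ a r f g (inside ∷ S) = begin
    head r * (a * x - y) - (tail r ∧ (λ T → a * f (inside ∷ T) - g (inside ∷ T))) S
      ≈⟨ +-cong (x[y-z]≈xy-xz _ _ _)
                (-‿cong (∧-linearʳ a (tail r) (f ∘ (inside ∷_)) (g ∘ (inside ∷_)) S)) ⟩
    (head r * (a * x) - head r * y) - (a * F - G)
      ≈⟨ +-cong (+-congʳ (*.x∙yz≈y∙xz _ _ _)) (sym (-‿+-comm _ _)) ⟩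
    (a * (head r * x) - head r * y) + (- (a * F) - - G)
      ≈⟨ +.interchange _ _ _ _ ⟩
    (a * (head r * x) - a * F) + (- (head r * y) - - G)
      ≈⟨ +-cong (sym (x[y-z]≈xy-xz _ _ _)) (-‿+-comm _ _) ⟩
    a * (head r * x - F) - (head r * y - G) ∎
    where
    x = f (outside ∷ S)
    y = g (outside ∷ S)
    F = (tail r ∧ (f ∘ (inside ∷_))) S
    G = (tail r ∧ (g ∘ (inside ∷_))) S

  ∧-anticomm : ∀ {n} (r s : Vector Carrier n) f → r ∧ s ∧ f ≈ᶠ λ S → - (s ∧ r ∧ f) S
  ∧-anticomm r s f [] = sym -0#≈0#
  ∧-anticomm r s f (outside ∷ S) = ∧-anticomm (tail r) (tail s) (f ∘ (outside ∷_)) S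
  ∧-anticomm r s f (inside ∷ S) = begin
    head r * (tail s ∧ f₀) S - (tail r ∧ (λ T → head s * f₀ T - (tail s ∧ f₁) T)) S
      ≈⟨ +-congˡ (-‿cong (∧-linearʳ _ (tail r) f₀ (tail s ∧ f₁) S)) ⟩
    head r * (tail s ∧ f₀) S - (head s * (tail r ∧ f₀) S - (tail r ∧ tail s ∧ f₁) S)
      ≈⟨ +-congˡ (-‿cong (+-congˡ (-‿cong (∧-anticomm (tail r) (tail s) f₁ S)))) ⟩
    head r * (tail s ∧ f₀) S - (head s * (tail r ∧ f₀) S - - (tail s ∧ tail r ∧ f₁) S)
      ≈⟨ rearrange _ _ _ ⟩
    - (head s * (tail r ∧ f₀) S - (head r * (tail s ∧ f₀) S - (tail s ∧ tail r ∧ f₁) S))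
      ≈⟨ -‿cong (+-congˡ (-‿cong (∧-linearʳ _ (tail s) f₀ (tail r ∧ f₁) S))) ⟨
    - (s ∧ r ∧ f) (inside ∷ S) ∎
    where
    f₀ = f ∘ (outside ∷_)
    f₁ = f ∘ (inside ∷_)
    rearrange : ∀ x y z → x - (y - - z) ≈ - (y - (x - z))
    rearrange x y z = begin
      x - (y - - z)     ≈⟨ +-congˡ (-‿+-comm _ _) ⟨
      x + (- y - - - z) ≈⟨ +-congˡ (+-congˡ (-‿cong (-‿involutive z))) ⟩
      x + (- y - z)     ≈⟨ +.x∙yz≈y∙xz _ _ _ ⟩
      - y + (x - z)     ≈⟨ +-congˡ (-‿involutive _) ⟨
      - y - - (x - z)   ≈⟨ -‿+-comm _ _ ⟩
      - (y - (x - z))   ∎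

  -- A direct recursion: the two terms with `head r` cancel. Deriving it from `∧-anticomm` would
  -- require division by 2.
  ∧-self : ∀ {n} (r : Vector Carrier n) f → r ∧ r ∧ f ≈ᶠ λ _ → 0#
  ∧-self r f [] = refl
  ∧-self r f (outside ∷ S) = ∧-self (tail r) (f ∘ (outside ∷_)) S
  ∧-self r f (inside ∷ S) = begin
    head r * (tail r ∧ f₀) S - (tail r ∧ (λ T → head r * f₀ T - (tail r ∧ f₁) T)) S
      ≈⟨ +-congˡ (-‿cong (∧-linearʳ _ (tail r) f₀ (tail r ∧ f₁) S)) ⟩
    head r * (tail r ∧ f₀) S - (head r * (tail r ∧ f₀) S - (tail r ∧ tail r ∧ f₁) S)
      ≈⟨ +-congˡ (-‿cong (+-congˡ (trans (-‿cong (∧-self (tail r) f₁ S)) -0#≈0#))) ⟩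
    head r * (tail r ∧ f₀) S - (head r * (tail r ∧ f₀) S + 0#)
      ≈⟨ +-congˡ (-‿cong (+-identityʳ _)) ⟩
    head r * (tail r ∧ f₀) S - head r * (tail r ∧ f₀) S
      ≈⟨ -‿inverseʳ _ ⟩
    0# ∎
    where
    f₀ = f ∘ (outside ∷_)
    f₁ = f ∘ (inside ∷_)

  ∧-zeroˡ : ∀ {n} {r : Vector Carrier n} → (∀ i → r i ≈ 0#) → ∀ f → r ∧ f ≈ᶠ λ _ → 0#
  ∧-zeroˡ r≈0 f []            = refl
  ∧-zeroˡ r≈0 f (outside ∷ S) = ∧-zeroˡ (r≈0 ∘ suc) _ S
  ∧-zeroˡ r≈0 f (inside ∷ S)  =
    trans (+-cong (trans (*-congʳ (r≈0 zero)) (zeroˡ _))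
                  (trans (-‿cong (∧-zeroˡ (r≈0 ∘ suc) _ S)) -0#≈0#))
          (+-identityʳ _)

  ∧-zeroʳ : ∀ {n} (r : Vector Carrier n) {f} → f ≈ᶠ (λ _ → 0#) → r ∧ f ≈ᶠ λ _ → 0#
  ∧-zeroʳ r f≈0 []            = refl
  ∧-zeroʳ r f≈0 (outside ∷ S) = ∧-zeroʳ (tail r) (f≈0 ∘ (outside ∷_)) S
  ∧-zeroʳ r f≈0 (inside ∷ S)  =
    trans (+-cong (trans (*-congˡ (f≈0 _)) (zeroʳ _))
                  (trans (-‿cong (∧-zeroʳ (tail r) (f≈0 ∘ (inside ∷_)) S)) -0#≈0#))
          (+-identityʳ _)

  -- Products of rows and determinants

  ⋀ : ∀ {k n} → Vector (Vector Carrier n) k → Form n → Form n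
  ⋀ M f = Vector.foldr _∧_ f M

  unit : ∀ {n} → Form n
  unit []            = 1#
  unit (outside ∷ S) = unit S
  unit (inside  ∷ S) = 0#

  ⋀-++ : ∀ m {k n} (M : Vector (Vector Carrier n) (m ℕ.+ k)) f →
         ⋀ M f ≈ᶠ ⋀ (λ i → M (i ↑ˡ k)) (⋀ (λ j → M (m ↑ʳ j)) f)
  ⋀-++ zero    M f S = refl
  ⋀-++ (suc m) M f   = ∧-congʳ (head M) (⋀-++ m (tail M) f)

  -- Setting the j-th generator to zero. This respects products, and on a product of rows it deletes
  -- column j.
  omit : ∀ {n} → Fin (suc n) → Form (suc n) → Form n
  omit j f S = f (insertAt S j outside)

  omit-∧ : ∀ {n} j (r : Vector Carrier (suc n)) f →
           omit j (r ∧ f) ≈ᶠ (r ∘ punchIn j) ∧ omit j f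
  omit-∧ zero    r f S             = refl
  omit-∧ (suc j) r f (outside ∷ S) = omit-∧ j (tail r) (f ∘ (outside ∷_)) S
  omit-∧ (suc j) r f (inside ∷ S)  =
    +-congˡ (-‿cong (omit-∧ j (tail r) (f ∘ (inside ∷_)) S))

  omit-unit : ∀ {n} (j : Fin (suc n)) → omit j unit ≈ᶠ unit
  omit-unit zero    S             = refl
  omit-unit (suc j) (outside ∷ S) = omit-unit j S
  omit-unit (suc j) (inside ∷ S)  = refl

  omit-⋀ : ∀ {k n} j (M : Vector (Vector Carrier (suc n)) k) →
           omit j (⋀ M unit) ≈ᶠ ⋀ (λ i → M i ∘ punchIn j) unit
  omit-⋀ {zero}  j M S = omit-unit j S
  omit-⋀ {suc k} j M S = trans (omit-∧ j (head M) (⋀ (tail M) unit) S)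
    (∧-congʳ (head M ∘ punchIn j) (omit-⋀ j (tail M)) S)

  -- To reach the full set, `r` must supply the one generator missing from the term of `f`. Moving
  -- it past the j earlier generators costs the sign of `alternate`.
  ∧-top : ∀ {n} (r : Vector Carrier (suc n)) f →
          (r ∧ f) ⊤ ≈ sum λ j → alternate (toℕ j) (r j * omit j f ⊤)
  ∧-top {zero}  r f = +-congˡ -0#≈0#
  ∧-top {suc n} r f = +-congˡ (trans (-‿cong (∧-top (tail r) (f ∘ (inside ∷_))))
    (sym (sum-neg {suc n} λ j → alternate (toℕ j) (r (suc j) * f (inside ∷ insertAt ⊤ j outside)))))

  -- The expansion of `∧-top` is the defining expansion of `det`, its minors being obtained by
  -- `omit`.
  det≈⋀ : ∀ {n} (M : Matrix n) → det M ≈ ⋀ M unit ⊤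
  det≈⋀ {zero}  M = refl
  det≈⋀ {suc n} M = trans
    (sum-cong-≋ λ j → alternate-cong (toℕ j) (*-congˡ {M zero j}
      (trans (det≈⋀ λ i k → M (suc i) (punchIn j k)) (sym (omit-⋀ j (tail M) ⊤)))))
    (sym (∧-top (head M) (⋀ (tail M) unit)))

  ⋀-cong : ∀ {k n} {M N : Vector (Vector Carrier n) k} {f g} →
           (∀ i j → M i j ≈ N i j) → f ≈ᶠ g → ⋀ M f ≈ᶠ ⋀ N g
  ⋀-cong {zero}  M≈N f≈g = f≈g
  ⋀-cong {suc k} M≈N f≈g = ∧-cong (M≈N zero) (⋀-cong (M≈N ∘ suc) f≈g)

  ∧-scaleʳ : ∀ {n} a (r : Vector Carrier n) f → r ∧ (λ S → a * f S) ≈ᶠ λ S → a * (r ∧ f) S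
  ∧-scaleʳ a r f S = begin
    (r ∧ (λ T → a * f T)) S                ≈⟨ ∧-congʳ r (λ T → minus-zero refl) S ⟨
    (r ∧ (λ T → a * f T - 0#)) S           ≈⟨ ∧-linearʳ a r f (λ _ → 0#) S ⟩
    a * (r ∧ f) S - (r ∧ (λ _ → 0#)) S     ≈⟨ minus-zero (∧-zeroʳ r (λ _ → refl) S) ⟩
    a * (r ∧ f) S                          ∎

  -- Up to sign, `r` can be moved past all rows of `M` until it meets `f`.
  ∧-⋀-zero : ∀ {k n} (r : Vector Carrier n) (M : Vector (Vector Carrier n) k) {f} →
             r ∧ f ≈ᶠ (λ _ → 0#) → r ∧ ⋀ M f ≈ᶠ λ _ → 0#
  ∧-⋀-zero {zero}  r M r∧f≈0   = r∧f≈0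
  ∧-⋀-zero {suc k} r M r∧f≈0 S = trans (∧-anticomm r (head M) _ S)
    (trans (-‿cong (∧-zeroʳ (head M) (∧-⋀-zero r (tail M) r∧f≈0) S)) -0#≈0#)

  -- The repeated row is moved, up to sign, next to its other occurrence.
  ∧-⋀-row : ∀ {k n} (M : Vector (Vector Carrier n) k) i f → M i ∧ ⋀ M f ≈ᶠ λ _ → 0#
  ∧-⋀-row M zero    f   = ∧-self (head M) _
  ∧-⋀-row M (suc i) f S = trans (∧-anticomm (M (suc i)) (head M) _ S)
    (trans (-‿cong (∧-zeroʳ (head M) (∧-⋀-row (tail M) i f) S)) -0#≈0#)

  combination : ∀ {k n} → Vector Carrier k → Vector (Vector Carrier n) k → Vector Carrier n
  combination a M j = sum λ i → a i * M i j

  ∧-combination-zero : ∀ {k n} (a : Vector Carrier k) (M : Vector (Vector Carrier n) k) {f} →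
                       (∀ i → M i ∧ f ≈ᶠ λ _ → 0#) → combination a M ∧ f ≈ᶠ λ _ → 0#
  ∧-combination-zero {zero}  a M     M∧f≈0 S = ∧-zeroˡ (λ _ → refl) _ S
  ∧-combination-zero {suc k} a M {f} M∧f≈0 S = begin
    (combination a M ∧ f) S
      ≈⟨ ∧-linearˡ (head a) (head M) (combination (tail a) (tail M)) f S ⟩
    head a * (head M ∧ f) S + (combination (tail a) (tail M) ∧ f) S
      ≈⟨ +-cong (trans (*-congˡ (M∧f≈0 zero S)) (zeroʳ _))
                (∧-combination-zero (tail a) (tail M) (M∧f≈0 ∘ suc) S) ⟩
    0# + 0#
      ≈⟨ +-identityʳ _ ⟩
    0# ∎

  -- Each correction `C i` annihilates `f` even through the remaining rows, so by linearity only the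
  -- factors x survive, one for each row.
  ⋀-rowOps : ∀ {k n} x (M C : Vector (Vector Carrier n) k) {f} →
             (∀ i → C i ∧ f ≈ᶠ λ _ → 0#) →
             ⋀ (λ i j → x * M i j + C i j) f ≈ᶠ λ S → x ^ k * ⋀ M f S
  ⋀-rowOps {zero}  x M C     C∧f≈0 S = sym (*-identityˡ _)
  ⋀-rowOps {suc k} x M C {f} C∧f≈0 S = begin
    ((λ j → x * M zero j + C zero j) ∧ W) S
      ≈⟨ ∧-linearˡ x (head M) (head C) W S ⟩
    x * (head M ∧ W) S + (head C ∧ W) S
      ≈⟨ +-congˡ (∧-⋀-zero (head C) (λ i j → x * M (suc i) j + C (suc i) j) (C∧f≈0 zero) S) ⟩
    x * (head M ∧ W) S + 0#
      ≈⟨ +-identityʳ _ ⟩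
    x * (head M ∧ W) S
      ≈⟨ *-congˡ (∧-congʳ (head M) (⋀-rowOps x (tail M) (tail C) (C∧f≈0 ∘ suc)) S) ⟩
    x * (head M ∧ (λ T → x ^ k * ⋀ (tail M) f T)) S
      ≈⟨ *-congˡ (∧-scaleʳ (x ^ k) (head M) (⋀ (tail M) f) S) ⟩
    x * (x ^ k * ⋀ M f S)
      ≈⟨ *-assoc _ _ _ ⟨
    x ^ suc k * ⋀ M f S ∎
    where W = ⋀ (λ i j → x * M (suc i) j + C (suc i) j) f

  -- The product of the lower rows is annihilated by each of those rows, hence by all their
  -- combinations. The upper rows are scaled, not the lower ones, and nothing is divided by x, so x
  -- = 0 is included.
  det-rowOps : ∀ n {q} x (M N : Matrix (n ℕ.+ q)) (C : Fin n → Vector Carrier q) →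
    (∀ i j → N (i ↑ˡ q) j ≈ x * M (i ↑ˡ q) j + combination (C i) (λ k → M (n ↑ʳ k)) j) →
    (∀ i j → N (n ↑ʳ i) j ≈ M (n ↑ʳ i) j) →
    det N ≈ x ^ n * det M
  det-rowOps n {q} x M N C above below = begin
    det N
      ≈⟨ det≈⋀ N ⟩
    ⋀ N unit ⊤
      ≈⟨ ⋀-++ n N unit ⊤ ⟩
    ⋀ (λ i → N (i ↑ˡ q)) (⋀ (λ k → N (n ↑ʳ k)) unit) ⊤
      ≈⟨ ⋀-cong above (⋀-cong below (λ _ → refl)) ⊤ ⟩
    ⋀ (λ i j → x * M (i ↑ˡ q) j + combination (C i) R j) (⋀ R unit) ⊤
      ≈⟨ ⋀-rowOps x (λ i → M (i ↑ˡ q)) (λ i → combination (C i) R)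
           (λ i → ∧-combination-zero (C i) R λ k → ∧-⋀-row R k unit) ⊤ ⟩
    x ^ n * ⋀ (λ i → M (i ↑ˡ q)) (⋀ R unit) ⊤
      ≈⟨ *-congˡ (trans (det≈⋀ M) (⋀-++ n M unit ⊤)) ⟨
    x ^ n * det M ∎
    where R = λ k → M (n ↑ʳ k)

  det-scale : ∀ {n} a (M : Matrix n) → det (λ i j → a * M i j) ≈ a ^ n * det M
  det-scale {n} a M = begin
    det aM                              ≈⟨ det≈⋀ aM ⟩
    ⋀ aM unit ⊤                         ≈⟨ ⋀-cong (λ i j → +-identityʳ (aM i j)) (λ S → refl {unit S}) ⊤ ⟨
    ⋀ (λ i j → aM i j + 0#) unit ⊤      ≈⟨ ⋀-rowOps a M (λ _ _ → 0#) (λ _ → ∧-zeroˡ (λ _ → refl) unit) ⊤ ⟩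
    a ^ n * ⋀ M unit ⊤                  ≈⟨ *-congˡ (det≈⋀ M) ⟨
    a ^ n * det M                       ∎
    where
    aM : Matrix n
    aM i j = a * M i j

  -- Replacing the first row by the combination with coefficients `s` multiplies the determinant by
  -- `s zero` and produces a zero row.
  det-dependent : ∀ {n} (M : Matrix (suc n)) (s : Vector Carrier (suc n)) →
                  (∀ j → combination s M j ≈ 0#) → s zero * det M ≈ 0#
  det-dependent M s sM≈0 = begin
    s zero * det M
      ≈⟨ *-congˡ (det≈⋀ M) ⟩
    s zero * (head M ∧ W) ⊤
      ≈⟨ +-identityʳ _ ⟨
    s zero * (head M ∧ W) ⊤ + 0#
      ≈⟨ +-congˡ (∧-combination-zero (tail s) (tail M) (λ i → ∧-⋀-row (tail M) i unit) ⊤) ⟨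
    s zero * (head M ∧ W) ⊤ + (combination (tail s) (tail M) ∧ W) ⊤
      ≈⟨ ∧-linearˡ (s zero) (head M) (combination (tail s) (tail M)) W ⊤ ⟨
    (combination s M ∧ W) ⊤
      ≈⟨ ∧-zeroˡ sM≈0 W ⊤ ⟩
    0# ∎
    where W = ⋀ (tail M) unit

  -- In the expansion along the first row only columns of the left block contribute. Their minors
  -- again have a zero upper right block and keep the same lower right block, so induction applies.
  det-block : ∀ n {q} (M : Matrix (n ℕ.+ q)) → (∀ i j → M (i ↑ˡ q) (n ↑ʳ j) ≈ 0#) →
              det M ≈ det (λ i j → M (i ↑ˡ q) (j ↑ˡ q)) * det (λ i j → M (n ↑ʳ i) (n ↑ʳ j))
  det-block zero    M M≈0 = sym (*-identityˡ _)
  det-block (suc n) {q} M M≈0 = begin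
    det M
      ≈⟨ sum-++ (suc n) term ⟩
    sum (λ j → term (j ↑ˡ q)) + sum (λ j → term (suc n ↑ʳ j))
      ≈⟨ +-cong (sum-cong-≋ expand)
                (sum-zero λ j → alternate-zero (toℕ (suc n ↑ʳ j)) (trans (*-congʳ (M≈0 zero j)) (zeroˡ _))) ⟩
    sum (λ j → alternate (toℕ j) (A zero j * det (minor j)) * D) + 0#
      ≈⟨ +-identityʳ _ ⟩
    sum (λ j → alternate (toℕ j) (A zero j * det (minor j)) * D)
      ≈⟨ *-distribʳ-sum D (λ j → alternate (toℕ j) (A zero j * det (minor j))) ⟨
    det A * D ∎
    where
    A = λ i j → M (i ↑ˡ q) (j ↑ˡ q)
    D = det λ i j → M (suc n ↑ʳ i) (suc n ↑ʳ j)
    minor = λ (j : Fin (suc n)) (i k : Fin n) → A (suc i) (punchIn j k)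
    term = λ j → alternate (toℕ j) (M zero j * det (λ i k → M (suc i) (punchIn j k)))

    expand : ∀ j → term (j ↑ˡ q) ≈ alternate (toℕ j) (A zero j * det (minor j)) * D
    expand j = begin
      term (j ↑ˡ q)
        ≡⟨ ≡.cong (λ t → alternate t (A zero j * det M′)) (toℕ-↑ˡ j q) ⟩
      alternate (toℕ j) (A zero j * det M′)
        ≈⟨ alternate-cong (toℕ j) (*-congˡ (det-block n M′ λ i k →
             trans (reflexive (≡.cong (M (suc (i ↑ˡ q))) (punchIn-↑ʳ j k))) (M≈0 (suc i) k))) ⟩
      alternate (toℕ j) (A zero j * (det (λ i k → M′ (i ↑ˡ q) (k ↑ˡ q)) * det (λ i k → M′ (n ↑ʳ i) (n ↑ʳ k))))
        ≈⟨ alternate-cong (toℕ j) (*-congˡ (*-cong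
             (det-cong λ i k → reflexive (≡.cong (M (suc (i ↑ˡ q))) (punchIn-↑ˡ j k)))
             (det-cong λ i k → reflexive (≡.cong (M (suc n ↑ʳ i)) (punchIn-↑ʳ j k))))) ⟩
      alternate (toℕ j) (A zero j * (det (minor j) * D))
        ≈⟨ alternate-cong (toℕ j) (sym (*-assoc _ _ _)) ⟩
      alternate (toℕ j) (A zero j * det (minor j) * D)
        ≈⟨ alternate-*ʳ (toℕ j) _ _ ⟩
      alternate (toℕ j) (A zero j * det (minor j)) * D ∎
      where M′ = λ i k → M (suc i) (punchIn (j ↑ˡ q) k)

  identity-≡ : ∀ {n} {i j : Fin n} → i ≡ j → identity i j ≡ 1#
  identity-≡ {i = i} {j} i≡j with i ≟ j
  ... | yes _  = ≡.refl
  ... | no i≢j = contradiction i≡j i≢j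

  identity-≢ : ∀ {n} {i j : Fin n} → ¬ (i ≡ j) → identity i j ≡ 0#
  identity-≢ {i = i} {j} i≢j with i ≟ j
  ... | yes i≡j = contradiction i≡j i≢j
  ... | no _    = ≡.refl

  identity-injective : ∀ {m n} {f : Fin m → Fin n} → Injective _≡_ _≡_ f →
                       ∀ i j → identity (f i) (f j) ≡ identity i j
  identity-injective {f = f} inj i j with i ≟ j
  ... | yes i≡j = identity-≡ (≡.cong f i≡j)
  ... | no i≢j  = identity-≢ (i≢j ∘ inj)

  sum-*-identity : ∀ {n} (t : Vector Carrier n) i → sum (λ k → t k * identity k i) ≈ t i
  sum-*-identity {n} t i = begin
    sum (λ k → t k * identity k i)
      ≈⟨ sum-isolate i (λ k k≢i → trans (*-congˡ (reflexive (identity-≢ k≢i))) (zeroʳ _)) ⟩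
    t i * identity i i
      ≈⟨ *-congˡ (reflexive (identity-≡ {n} {i} ≡.refl)) ⟩
    t i * 1#
      ≈⟨ *-identityʳ _ ⟩
    t i ∎

  det-scalar : ∀ n x → det {n} (λ i j → x * identity i j) ≈ x ^ n
  det-scalar zero    x = refl
  det-scalar (suc n) x = begin
    det xI
      ≈⟨ det-block 1 xI (λ { zero j → trans (*-congˡ (reflexive (identity-≢ {i = zero} {suc j} λ ()))) (zeroʳ x) }) ⟩
    (x * identity {suc n} zero zero * 1# + 0#) * det (λ i j → xI (suc i) (suc j))
      ≈⟨ *-cong (trans (+-identityʳ _) (*-identityʳ _))
                (det-cong {n} λ i j → *-congˡ {x} (reflexive (identity-injective suc-injective i j))) ⟩
    x * identity {suc n} zero zero * det {n} (λ i j → x * identity i j)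
      ≈⟨ *-cong (trans (*-congˡ (reflexive (identity-≡ {suc n} {zero} ≡.refl))) (*-identityʳ x))
                (det-scalar n x) ⟩
    x ^ suc n ∎
    where
    xI : Matrix (suc n)
    xI i j = x * identity i j

  -- Adding to x times the upper rows of (xI -B; -Bᵀ xI) the combinations of
  -- the lower rows with coefficients B makes the matrix lower block triangular.
  charPoly-bipartite : ∀ n {q} (A : Matrix (n ℕ.+ q)) (B : Fin n → Fin q → Carrier) →
    (∀ i j → A (i ↑ˡ q) (j ↑ˡ q) ≈ 0#) → (∀ i j → A (i ↑ˡ q) (n ↑ʳ j) ≈ B i j) →
    (∀ i j → A (n ↑ʳ i) (j ↑ˡ q) ≈ B j i) → (∀ i j → A (n ↑ʳ i) (n ↑ʳ j) ≈ 0#) →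
    ∀ x → x ^ n * charPoly A x ≈
          x ^ q * det (λ i j → x * x * identity i j - sum (λ k → B i k * B j k))
  charPoly-bipartite n {q} A B A₁₁ A₁₂ A₂₁ A₂₂ x = begin
    x ^ n * det M
      ≈⟨ det-rowOps n x M N B (λ i j → reflexive (≡.cong-app (lookup-++ˡ above below i) j))
                              (λ i j → reflexive (≡.cong-app (lookup-++ʳ above below i) j)) ⟨
    det N
      ≈⟨ det-block n N (λ i j → trans (reflexive (≡.cong-app (lookup-++ˡ above below i) _)) (above₂≈0 i j)) ⟩
    det (λ i j → N (i ↑ˡ q) (j ↑ˡ q)) * det (λ i j → N (n ↑ʳ i) (n ↑ʳ j))
      ≈⟨ *-cong (det-cong λ i j → trans (reflexive (≡.cong-app (lookup-++ˡ above below i) _)) (above₁ i j))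
                (trans (det-cong λ i j → trans (reflexive (≡.cong-app (lookup-++ʳ above below i) _)) (M₂₂ i j))
                       (det-scalar q x)) ⟩
    det (λ i j → x * x * identity i j - sum (λ k → B i k * B j k)) * x ^ q
      ≈⟨ *-comm _ _ ⟩
    x ^ q * det (λ i j → x * x * identity i j - sum (λ k → B i k * B j k)) ∎
    where
    M = λ i j → x * identity i j - A i j
    below = λ k → M (n ↑ʳ k)
    above = λ i j → x * M (i ↑ˡ q) j + combination (B i) below j
    N = above Vector.++ below

    M₁₁ : ∀ i j → M (i ↑ˡ q) (j ↑ˡ q) ≈ x * identity i j
    M₁₁ i j = trans (minus-zero (A₁₁ i j))
      (*-congˡ (reflexive (identity-injective (↑ˡ-injective q _ _) i j)))

    M₁₂ : ∀ i j → M (i ↑ˡ q) (n ↑ʳ j) ≈ - B i j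
    M₁₂ i j = trans (+-cong (trans (*-congˡ (reflexive (identity-≢ (↑ˡ≢↑ʳ i j)))) (zeroʳ x))
                            (-‿cong (A₁₂ i j)))
                    (+-identityˡ _)

    M₂₁ : ∀ i j → M (n ↑ʳ i) (j ↑ˡ q) ≈ - B j i
    M₂₁ i j = trans (+-cong (trans (*-congˡ (reflexive (identity-≢ (↑ˡ≢↑ʳ j i ∘ ≡.sym)))) (zeroʳ x))
                            (-‿cong (A₂₁ i j)))
                    (+-identityˡ _)

    M₂₂ : ∀ i j → M (n ↑ʳ i) (n ↑ʳ j) ≈ x * identity i j
    M₂₂ i j = trans (minus-zero (A₂₂ i j))
      (*-congˡ (reflexive (identity-injective (↑ʳ-injective n _ _) i j)))

    above₁ : ∀ i j → above i (j ↑ˡ q) ≈ x * x * identity i j - sum (λ k → B i k * B j k)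
    above₁ i j = +-cong
      (trans (*-congˡ (M₁₁ i j)) (sym (*-assoc _ _ _)))
      (trans (sum-cong-≋ λ k → trans (*-congˡ (M₂₁ k j)) (sym (-‿distribʳ-* (B i k) (B j k))))
             (sum-neg λ k → B i k * B j k))

    above₂≈0 : ∀ i j → above i (n ↑ʳ j) ≈ 0#
    above₂≈0 i j = begin
      x * M (i ↑ˡ q) (n ↑ʳ j) + sum (λ k → B i k * M (n ↑ʳ k) (n ↑ʳ j))
        ≈⟨ +-cong (trans (*-congˡ (M₁₂ i j)) (sym (-‿distribʳ-* _ _)))
                  (sum-cong-≋ λ k → trans (*-congˡ (M₂₂ k j)) (*.x∙yz≈yx∙z (B i k) x (identity k j))) ⟩
      - (x * B i j) + sum (λ k → x * B i k * identity k j)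
        ≈⟨ +-congˡ (sum-*-identity (λ k → x * B i k) j) ⟩
      - (x * B i j) + x * B i j
        ≈⟨ -‿inverseˡ _ ⟩
      0# ∎

  -- Polynomial functions

  open IsStrictPartialOrder isStrictPartialOrder
    using () renaming (irrefl to <ᶠ-irrefl; trans to <ᶠ-trans; <-respˡ-≈ to <ᶠ-respˡ; <-respʳ-≈ to <ᶠ-respʳ)

  +-pos : ∀ {x y} → 0# <ᶠ x → 0# <ᶠ y → 0# <ᶠ x + y
  +-pos {x} {y} 0<x 0<y = <ᶠ-trans 0<y (<ᶠ-respˡ (+-identityˡ y) (+-monoˡ-< y 0<x))

  -- As ≤ is a negated <, it suffices to refute x + y < 0. Cotransitivity places x next to this gap:
  -- either x < 0, or x + y < x and so y < 0.
  +-nonneg : ∀ {x y} → 0# ≤ᶠ x → 0# ≤ᶠ y → 0# ≤ᶠ x + y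
  +-nonneg {x} {y} 0≤x 0≤y x+y<0 with compare x+y<0 x
  ... | inj₂ x<0   = 0≤x x<0
  ... | inj₁ x+y<x = 0≤y (<ᶠ-respˡ cancel (<ᶠ-respʳ (-‿inverseʳ x) (+-monoˡ-< (- x) x+y<x)))
    where
    cancel : x + y - x ≈ y
    cancel = begin
      x + y - x     ≈⟨ +.xy∙z≈y∙xz x y (- x) ⟩
      y + (x - x)   ≈⟨ minus-self ⟩
      y             ∎
      where minus-self = trans (+-congˡ (-‿inverseʳ x)) (+-identityʳ y)

  ·-nonneg : ∀ p {x} → 0# ≤ᶠ x → 0# ≤ᶠ p · x
  ·-nonneg zero    0≤x = <ᶠ-irrefl refl
  ·-nonneg (suc p) 0≤x = +-nonneg 0≤x (·-nonneg p 0≤x)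

  ·1-pos : ∀ p .{{_ : NonZero p}} → 0# <ᶠ p · 1#
  ·1-pos (suc zero)    = <ᶠ-respʳ (sym (+-identityʳ 1#)) 0<1
  ·1-pos (suc (suc p)) = +-pos 0<1 (·1-pos (suc p))

  ^-pos : ∀ n {x} → 0# <ᶠ x → 0# <ᶠ x ^ n
  ^-pos zero    0<x = 0<1
  ^-pos (suc n) 0<x = *-pos 0<x (^-pos n 0<x)

  *-cancelˡ-pos : ∀ {x y z} → 0# <ᶠ x → x * y ≈ x * z → y ≈ z
  *-cancelˡ-pos {x} {y} {z} 0<x xy≈xz with w , xw≈1 ← inverse 0<x = begin
    y           ≈⟨ divide y ⟨
    w * (x * y) ≈⟨ *-congˡ xy≈xz ⟩
    w * (x * z) ≈⟨ divide z ⟩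
    z           ∎
    where
    divide : ∀ t → w * (x * t) ≈ t
    divide t = trans (*.x∙yz≈yx∙z w x t) (trans (*-congʳ xw≈1) (*-identityˡ t))

  *-zero-pos : ∀ {x y} → 0# <ᶠ x → x * y ≈ 0# → y ≈ 0#
  *-zero-pos {x} 0<x xy≈0 = *-cancelˡ-pos 0<x (trans xy≈0 (sym (zeroʳ x)))

  -- Horner form; the index bounds the number of coefficients.
  IsPolynomial : ℕ → (Carrier → Carrier) → Set _
  IsPolynomial zero    f = ∀ x → f x ≈ 0#
  IsPolynomial (suc d) f =
    ∃ λ a → ∃ λ g → IsPolynomial d g × ∀ x → f x ≈ a + x * g x

  Polynomial : (Carrier → Carrier) → Set _
  Polynomial f = ∃ λ d → IsPolynomial d f

  isPolynomial-resp : ∀ d {f g} → (∀ x → f x ≈ g x) → IsPolynomial d f → IsPolynomial d g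
  isPolynomial-resp zero    f≈g f≈0              = λ x → trans (sym (f≈g x)) (f≈0 x)
  isPolynomial-resp (suc d) f≈g (a , h , ph , f≈) = a , h , ph , λ x → trans (sym (f≈g x)) (f≈ x)

  polynomial-resp : ∀ {f g} → (∀ x → f x ≈ g x) → Polynomial f → Polynomial g
  polynomial-resp f≈g (d , pf) = d , isPolynomial-resp d f≈g pf

  isPolynomial-+ : ∀ d e {f g} → IsPolynomial d f → IsPolynomial e g →
                   IsPolynomial (d ⊔ e) (λ x → f x + g x)
  isPolynomial-+ zero e f≈0 pg =
    isPolynomial-resp e (λ x → sym (trans (+-congʳ (f≈0 x)) (+-identityˡ _))) pg
  isPolynomial-+ (suc d) zero pf g≈0 =
    isPolynomial-resp (suc d) (λ x → sym (trans (+-congˡ (g≈0 x)) (+-identityʳ _))) pf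
  isPolynomial-+ (suc d) (suc e) {f} {g} (a , f′ , pf′ , f≈) (b , g′ , pg′ , g≈) =
    a + b , _ , isPolynomial-+ d e pf′ pg′ , λ x → begin
      f x + g x                         ≈⟨ +-cong (f≈ x) (g≈ x) ⟩
      (a + x * f′ x) + (b + x * g′ x)   ≈⟨ +.interchange _ _ _ _ ⟩
      (a + b) + (x * f′ x + x * g′ x)   ≈⟨ +-congˡ (distribˡ _ _ _) ⟨
      (a + b) + x * (f′ x + g′ x)       ∎

  isPolynomial-scale : ∀ d a {f} → IsPolynomial d f → IsPolynomial d (λ x → a * f x)
  isPolynomial-scale zero    a f≈0 = λ x → trans (*-congˡ (f≈0 x)) (zeroʳ a)
  isPolynomial-scale (suc d) a {f} (b , g , pg , f≈) =
    a * b , _ , isPolynomial-scale d a pg , λ x → begin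
      a * f x                  ≈⟨ *-congˡ (f≈ x) ⟩
      a * (b + x * g x)        ≈⟨ distribˡ _ _ _ ⟩
      a * b + a * (x * g x)    ≈⟨ +-congˡ (*.x∙yz≈y∙xz _ _ _) ⟩
      a * b + x * (a * g x)    ∎

  polynomial-const : ∀ a → Polynomial (λ _ → a)
  polynomial-const a = 1 , a , (λ _ → 0#) , (λ _ → refl) ,
    λ x → sym (trans (+-congˡ (zeroʳ x)) (+-identityʳ a))

  polynomial-x* : ∀ {f} → Polynomial f → Polynomial (λ x → x * f x)
  polynomial-x* {f} (d , pf) = suc d , 0# , f , pf , λ x → sym (+-identityˡ _)

  polynomial-+ : ∀ {f g} → Polynomial f → Polynomial g → Polynomial (λ x → f x + g x)
  polynomial-+ (d , pf) (e , pg) = d ⊔ e , isPolynomial-+ d e pf pg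

  polynomial-scale : ∀ a {f} → Polynomial f → Polynomial (λ x → a * f x)
  polynomial-scale a (d , pf) = d , isPolynomial-scale d a pf

  polynomial-neg : ∀ {f} → Polynomial f → Polynomial (λ x → - f x)
  polynomial-neg pf = polynomial-resp (λ x → -1*x≈-x _) (polynomial-scale (- 1#) pf)

  polynomial-* : ∀ {f g} → Polynomial f → Polynomial g → Polynomial (λ x → f x * g x)
  polynomial-* (zero , f≈0) pg =
    0 , λ x → trans (*-congʳ (f≈0 x)) (zeroˡ _)
  polynomial-* {f} {g} (suc d , a , f′ , pf′ , f≈) pg =
    polynomial-resp
      (λ x → begin
        a * g x + x * (f′ x * g x)    ≈⟨ +-congˡ (*-assoc _ _ _) ⟨
        a * g x + x * f′ x * g x      ≈⟨ distribʳ _ _ _ ⟨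
        (a + x * f′ x) * g x          ≈⟨ *-congʳ (f≈ x) ⟨
        f x * g x                     ∎)
      (polynomial-+ (polynomial-scale a pg) (polynomial-x* (polynomial-* (d , pf′) pg)))

  polynomial-x : Polynomial (λ x → x)
  polynomial-x = polynomial-resp *-identityʳ (polynomial-x* (polynomial-const 1#))

  polynomial-alternate : ∀ k {f} → Polynomial f → Polynomial (λ x → alternate k (f x))
  polynomial-alternate zero    pf = pf
  polynomial-alternate (suc k) pf = polynomial-neg (polynomial-alternate k pf)

  polynomial-sum : ∀ {n} {f : Fin n → Carrier → Carrier} →
                   (∀ i → Polynomial (f i)) → Polynomial (λ x → sum λ i → f i x)
  polynomial-sum {zero}  pf = 0 , λ _ → refl
  polynomial-sum {suc n} pf = polynomial-+ (pf zero) (polynomial-sum (pf ∘ suc))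

  polynomial-det : ∀ {n} {M : Fin n → Fin n → Carrier → Carrier} →
                   (∀ i j → Polynomial (M i j)) → Polynomial (λ x → det λ i j → M i j x)
  polynomial-det {zero}  pM = polynomial-const 1#
  polynomial-det {suc n} pM = polynomial-sum λ j → polynomial-alternate (toℕ j)
    (polynomial-* (pM zero j) (polynomial-det λ i k → pM (suc i) (punchIn j k)))

  polynomial-charPoly : ∀ {n} (M : Matrix n) → Polynomial (charPoly M)
  polynomial-charPoly M = polynomial-det λ i j →
    polynomial-+ (polynomial-* polynomial-x (polynomial-const (identity i j)))
                 (polynomial-const (- M i j))

  -- The index must stay the same, since the induction on the number of coefficients in
  -- `isPolynomial-zero` runs over translated functions. It is computed as a maximum, which the
  -- `subst` evaluates to `suc d`.
  isPolynomial-translate : ∀ d {f} → IsPolynomial d f → IsPolynomial d (λ x → f (x + 1#))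
  isPolynomial-translate zero    f≈0 = λ x → f≈0 (x + 1#)
  isPolynomial-translate (suc d) {f} (a , g , pg , f≈) =
    ≡.subst (λ e → IsPolynomial e (λ x → f (x + 1#)))
      (ℕ.m≤n⇒m⊔n≡n (ℕ.⊔-lub (ℕ.s≤s ℕ.z≤n) (ℕ.n≤1+n d)))
      (isPolynomial-resp ((1 ⊔ d) ⊔ suc d)
        (λ x → begin
          (a + g (x + 1#)) + x * g (x + 1#)         ≈⟨ +.xy∙z≈x∙zy _ _ _ ⟩
          a + (x * g (x + 1#) + g (x + 1#))         ≈⟨ +-congˡ (+-congˡ (*-identityˡ _)) ⟨
          a + (x * g (x + 1#) + 1# * g (x + 1#))    ≈⟨ +-congˡ (distribʳ _ _ _) ⟨
          a + (x + 1#) * g (x + 1#)                 ≈⟨ f≈ (x + 1#) ⟨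
          f (x + 1#)                                ∎)
        (isPolynomial-+ (1 ⊔ d) (suc d)
          (isPolynomial-+ 1 d (a , (λ _ → 0#) , (λ _ → refl) ,
                               λ x → sym (trans (+-congˡ (zeroʳ x)) (+-identityʳ a))) pg′)
          (0# , _ , pg′ , λ x → sym (+-identityˡ _))))
    where pg′ = isPolynomial-translate d pg

  -- Write f (x + 1) = a + x g(x).  Then a = f(1) = 0, so g vanishes at every
  -- positive point too, and it has one coefficient fewer.
  isPolynomial-zero : ∀ d {f} → IsPolynomial d f →
                      (∀ x → 0# <ᶠ x → f x ≈ 0#) → ∀ x → f x ≈ 0#
  isPolynomial-zero zero    f≈0 _ = f≈0
  isPolynomial-zero (suc d) {f} pf f≈0⁺ x
    with a , g , pg , f≈ ← isPolynomial-translate (suc d) {f} pf = begin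
    f x                              ≈⟨ f-cong x-1+1≈x ⟨
    f (x - 1# + 1#)                  ≈⟨ f≈ (x - 1#) ⟩
    a + (x - 1#) * g (x - 1#)        ≈⟨ +-cong a≈0 (trans (*-congˡ (g≈0 (x - 1#))) (zeroʳ _)) ⟩
    0# + 0#                          ≈⟨ +-identityʳ 0# ⟩
    0#                               ∎
    where
    x-1+1≈x : x - 1# + 1# ≈ x
    x-1+1≈x = trans (+-assoc _ _ _) (trans (+-congˡ (-‿inverseˡ 1#)) (+-identityʳ x))

    -- A bare function need not respect the equality of the field; one in Horner form does.
    f-cong : ∀ {y z} → y ≈ z → f y ≈ f z
    f-cong = isPolynomial-cong (suc d) pf
      where
      isPolynomial-cong : ∀ d {f} → IsPolynomial d f → ∀ {y z} → y ≈ z → f y ≈ f z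
      isPolynomial-cong zero    f≈0 y≈z = trans (f≈0 _) (sym (f≈0 _))
      isPolynomial-cong (suc d) (a , g , pg , f≈) y≈z = trans (f≈ _)
        (trans (+-congˡ (*-cong y≈z (isPolynomial-cong d pg y≈z))) (sym (f≈ _)))

    a≈0 : a ≈ 0#
    a≈0 = begin
      a               ≈⟨ +-identityʳ a ⟨
      a + 0#          ≈⟨ +-congˡ (zeroˡ _) ⟨
      a + 0# * g 0#   ≈⟨ f≈ 0# ⟨
      f (0# + 1#)     ≈⟨ f≈0⁺ (0# + 1#) (<ᶠ-respʳ (sym (+-identityˡ 1#)) 0<1) ⟩
      0#              ∎

    g≈0 : ∀ y → g y ≈ 0#
    g≈0 = isPolynomial-zero d pg λ y 0<y → *-zero-pos 0<y (begin
      y * g y         ≈⟨ +-identityˡ _ ⟨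
      0# + y * g y    ≈⟨ +-congʳ a≈0 ⟨
      a + y * g y     ≈⟨ f≈ y ⟨
      f (y + 1#)      ≈⟨ f≈0⁺ (y + 1#) (+-pos 0<y 0<1) ⟩
      0#              ∎)

  -- For n > 0 the hypothesis says nothing at x = 0. At positive x the power is invertible, so the
  -- difference vanishes there, and a polynomial function vanishing at all positive points is zero.
  polynomial-cancel : ∀ n {f g} → Polynomial f → Polynomial g →
                      (∀ x → x ^ n * f x ≈ x ^ n * g x) → ∀ x → f x ≈ g x
  polynomial-cancel n {f} {g} pf pg eq x = x∙y⁻¹≈ε⇒x≈y (f x) (g x)
    (isPolynomial-zero (proj₁ pf-g) (proj₂ pf-g)
      (λ y 0<y → x≈y⇒x∙y⁻¹≈ε (*-cancelˡ-pos (^-pos n 0<y) (eq y))) x)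
    where
    pf-g : Polynomial (λ x → f x - g x)
    pf-g = polynomial-+ pf (polynomial-neg pg)

  -- Products over a list of roots

  ∏[_-_] : Carrier → List Carrier → Carrier
  ∏[ x - ls ] = List.foldr (λ l y → (x - l) * y) 1# ls

  polynomial-∏ : ∀ ls → Polynomial (λ x → ∏[ x - ls ])
  polynomial-∏ []       = polynomial-const 1#
  polynomial-∏ (l ∷ ls) =
    polynomial-* (polynomial-+ polynomial-x (polynomial-const (- l))) (polynomial-∏ ls)

  ∏-++ : ∀ x ks ls → ∏[ x - ks ++ ls ] ≈ ∏[ x - ks ] * ∏[ x - ls ]
  ∏-++ x []       ls = sym (*-identityˡ _)
  ∏-++ x (k ∷ ks) ls = trans (*-congˡ (∏-++ x ks ls)) (sym (*-assoc _ _ _))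

  ∏-replicate-0 : ∀ x k → ∏[ x - replicate k 0# ] ≈ x ^ k
  ∏-replicate-0 x zero    = refl
  ∏-replicate-0 x (suc k) = *-cong (minus-zero refl) (∏-replicate-0 x k)

  ∏-tabulate-cong : ∀ {n x y} {f g : Fin n → Carrier} → x ≈ y → (∀ i → f i ≈ g i) →
                    ∏[ x - tabulate f ] ≈ ∏[ y - tabulate g ]
  ∏-tabulate-cong {zero}  x≈y f≈g = refl
  ∏-tabulate-cong {suc n} x≈y f≈g =
    *-cong (+-cong x≈y (-‿cong (f≈g zero))) (∏-tabulate-cong x≈y (f≈g ∘ suc))

  ∏-tabulate-scale : ∀ {n} a x (f : Fin n → Carrier) →
                     a ^ n * ∏[ x - tabulate f ] ≈ ∏[ a * x - tabulate (λ i → a * f i) ]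
  ∏-tabulate-scale {zero}  a x f = *-identityˡ 1#
  ∏-tabulate-scale {suc n} a x f = trans (*.interchange _ _ _ _)
    (*-cong (x[y-z]≈xy-xz _ _ _) (∏-tabulate-scale a x (f ∘ suc)))

  ∏-tabulate-last : ∀ {k} x (f : Fin (suc k) → Carrier) →
                    ∏[ x - tabulate f ] ≈ ∏[ x - tabulate (f ∘ inject₁) ] * (x - f (fromℕ k))
  ∏-tabulate-last {zero}  x f = *-comm _ _
  ∏-tabulate-last {suc k} x f =
    trans (*-congˡ (∏-tabulate-last x (f ∘ suc))) (sym (*-assoc _ _ _))

  ∏-±√ : ∀ x {a} → 0# ≤ᶠ a → ∏[ x - ±√ a ] ≈ x * x - a
  ∏-±√ x {a} 0≤a = begin
    (x - r) * ((x - - r) * 1#)      ≈⟨ *-congˡ (trans (*-identityʳ _) (+-congˡ (-‿involutive r))) ⟩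
    (x - r) * (x + r)               ≈⟨ distribˡ _ _ _ ⟩
    (x - r) * x + (x - r) * r       ≈⟨ +-cong ([y-z]x≈yx-zx x x r) ([y-z]x≈yx-zx r x r) ⟩
    (x * x - r * x) + (x * r - r * r)
      ≈⟨ +-assoc _ _ _ ⟩
    x * x + (- (r * x) + (x * r - r * r))
      ≈⟨ +-congˡ (+-assoc _ _ _) ⟨
    x * x + ((- (r * x) + x * r) - r * r)
      ≈⟨ +-congˡ (+-congʳ (trans (+-congˡ (*-comm x r)) (-‿inverseˡ _))) ⟩
    x * x + (0# - r * r)            ≈⟨ +-congˡ (+-identityˡ _) ⟩
    x * x - r * r                   ≈⟨ +-congˡ (-‿cong (√-square 0≤a)) ⟩
    x * x - a                       ∎
    where r = √ a

  ∏-concatMap-±√ : ∀ {A : Set} {n} x (h : A → Carrier) → (∀ a → 0# ≤ᶠ h a) → (f : Fin n → A) →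
                   ∏[ x - concatMap (λ a → ±√ (h a)) (tabulate f) ] ≈
                   ∏[ x * x - tabulate (h ∘ f) ]
  ∏-concatMap-±√ {n = zero}  x h 0≤h f = refl
  ∏-concatMap-±√ {n = suc n} x h 0≤h f = begin
    ∏[ x - ±√ (h (f zero)) ++ concatMap (λ a → ±√ (h a)) (tabulate (f ∘ suc)) ]
      ≈⟨ ∏-++ x (±√ (h (f zero))) (concatMap (λ a → ±√ (h a)) (tabulate (f ∘ suc))) ⟩
    ∏[ x - ±√ (h (f zero)) ] * ∏[ x - concatMap (λ a → ±√ (h a)) (tabulate (f ∘ suc)) ]
      ≈⟨ *-cong (∏-±√ x (0≤h (f zero))) (∏-concatMap-±√ x h 0≤h (f ∘ suc)) ⟩
    ∏[ x * x - tabulate (h ∘ f) ] ∎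

  -- The factors at 0 are the negatives of the f(i). Cancelling one of them at a time avoids
  -- tracking the sign of the whole product.
  ∏-pos : ∀ {n} (f : Fin n → Carrier) → (∀ i → 0# <ᶠ f i) → ¬ (∏[ 0# - tabulate f ] ≈ 0#)
  ∏-pos {zero}  f 0<f 1≈0 = <ᶠ-irrefl (sym 1≈0) 0<1
  ∏-pos {suc n} f 0<f ∏≈0 = ∏-pos (f ∘ suc) (0<f ∘ suc) (*-zero-pos (0<f zero) (begin
    f zero * P              ≈⟨ -‿involutive _ ⟨
    - - (f zero * P)        ≈⟨ -‿cong (-‿distribˡ-* _ _) ⟩
    - (- f zero * P)        ≈⟨ -‿cong (*-congʳ (+-identityˡ _)) ⟨
    - ((0# - f zero) * P)   ≈⟨ -‿cong ∏≈0 ⟩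
    - 0#                    ≈⟨ -0#≈0# ⟩
    0#                      ∎))
    where P = ∏[ 0# - tabulate (f ∘ suc) ]

  -- A positive least root would make all roots positive and the product nonzero. Tightness turns
  -- this refutation into an equality.
  ∏≈0⇒last≈0 : ∀ {k} (f : Fin (suc k) → Carrier) → (∀ i → f (fromℕ k) ≤ᶠ f i) →
               0# ≤ᶠ f (fromℕ k) → ∏[ 0# - tabulate f ] ≈ 0# → f (fromℕ k) ≈ 0#
  ∏≈0⇒last≈0 {k} f least nonneg ∏≈0 = tight nonneg λ 0<last → ∏-pos f
    (λ i → all-pos i 0<last) ∏≈0
    where
    all-pos : ∀ i → 0# <ᶠ f (fromℕ k) → 0# <ᶠ f i
    all-pos i 0<last with compare 0<last (f i)
    ... | inj₁ 0<fi   = 0<fi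
    ... | inj₂ fi<last = contradiction fi<last (least i)

  -- Shared by both cases: r is pm in the unbalanced one and pm + 2 in the balanced one, where l is
  -- one less than n. The bound n ≤ r makes r ∸ n a true difference.
  hasSpectrum-±√ : ∀ {n N l r} (A : Matrix N) (h : Fin l → Carrier) → (∀ i → 0# ≤ᶠ h i) → n ℕ.≤ r →
    (∀ x → x ^ n * charPoly A x ≈ x ^ r * ∏[ x * x - tabulate h ]) →
    HasSpectrum A (replicate (r ∸ n) 0# ++ concatMap (λ i → ±√ (h i)) (allFin l))
  hasSpectrum-±√ {n} {l = l} {r} A h 0≤h n≤r eq =
    polynomial-cancel n (polynomial-charPoly A) (polynomial-∏ (zeros ++ roots)) λ x → begin
      x ^ n * charPoly A x
        ≈⟨ eq x ⟩
      x ^ r * ∏[ x * x - tabulate h ]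
        ≈⟨ *-cong (split x) (sym (∏-concatMap-±√ x h 0≤h (λ i → i))) ⟩
      x ^ n * x ^ (r ∸ n) * ∏[ x - roots ]
        ≈⟨ *-assoc _ _ _ ⟩
      x ^ n * (x ^ (r ∸ n) * ∏[ x - roots ])
        ≈⟨ *-congˡ (trans (∏-++ x zeros roots) (*-congʳ (∏-replicate-0 x (r ∸ n)))) ⟨
      x ^ n * ∏[ x - zeros ++ roots ] ∎
    where
    zeros = replicate (r ∸ n) 0#
    roots = concatMap (λ i → ±√ (h i)) (allFin l)

    split : ∀ x → x ^ r ≈ x ^ n * x ^ (r ∸ n)
    split x = trans (reflexive (≡.cong (x ^_) (≡.sym (ℕ.m+[n∸m]≡n n≤r)))) (^-homo-* x n (r ∸ n))

  -- The root 0 contributes a factor x², which joins the power of x. This is the origin of the 2 in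
  -- pm - n + 2.
  ∏-square-last : ∀ {k} x q (f : Fin (suc k) → Carrier) → f (fromℕ k) ≈ 0# →
                  x ^ q * ∏[ x * x - tabulate f ] ≈
                  x ^ (q ℕ.+ 2) * ∏[ x * x - tabulate (f ∘ inject₁) ]
  ∏-square-last x q f last≈0 = begin
    x ^ q * ∏[ x * x - tabulate f ]
      ≈⟨ *-congˡ (trans (∏-tabulate-last (x * x) f) (*-congˡ (minus-zero last≈0))) ⟩
    x ^ q * (∏[ x * x - tabulate (f ∘ inject₁) ] * (x * x))
      ≈⟨ *.x∙yz≈xz∙y _ _ _ ⟩
    x ^ q * (x * x) * ∏[ x * x - tabulate (f ∘ inject₁) ]
      ≈⟨ *-congʳ (trans (^-homo-* x q 2) (*-congˡ (*-congˡ (*-identityʳ x)))) ⟨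
    x ^ (q ℕ.+ 2) * ∏[ x * x - tabulate (f ∘ inject₁) ] ∎

  module _ {n q : ℕ} (A : Matrix (n ℕ.+ q)) (B : Fin n → Fin q → Carrier)
           (A₁₁ : ∀ i j → A (i ↑ˡ q) (j ↑ˡ q) ≈ 0#) (A₁₂ : ∀ i j → A (i ↑ˡ q) (n ↑ʳ j) ≈ B i j)
           (A₂₁ : ∀ i j → A (n ↑ʳ i) (j ↑ˡ q) ≈ B j i) (A₂₂ : ∀ i j → A (n ↑ʳ i) (n ↑ʳ j) ≈ 0#)
           (L : Matrix n) (p : ℕ) .{{p≢0 : NonZero p}}
           (BBᵀ≈pL : ∀ i j → sum (λ k → B i k * B j k) ≈ p · L i j)
           (μ : Fin n → Carrier) (specL : HasSpectrum L (tabulate μ)) where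

    -- The hypothesis `specL` concerns L and not pL, so x²I - pL is written as p(yI - L) with y =
    -- x²/p. The factor pⁿ then turns the roots μᵢ at y into pμᵢ at x².
    charPoly-spectrum : ∀ x → x ^ n * charPoly A x ≈ x ^ q * ∏[ x * x - tabulate (λ i → p · μ i) ]
    charPoly-spectrum x with w , Pw≈1 ← inverse (·1-pos p) = begin
      x ^ n * charPoly A x
        ≈⟨ charPoly-bipartite n A B A₁₁ A₁₂ A₂₁ A₂₂ x ⟩
      x ^ q * det (λ i j → x * x * identity i j - sum (λ k → B i k * B j k))
        ≈⟨ *-congˡ (det-cong λ i j → entry i j) ⟩
      x ^ q * det (λ i j → P * (y * identity i j - L i j))
        ≈⟨ *-congˡ (trans (det-scale P (λ i j → y * identity i j - L i j)) (*-congˡ (specL y))) ⟩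
      x ^ q * (P ^ n * ∏[ y - tabulate μ ])
        ≈⟨ *-congˡ (trans (∏-tabulate-scale P y μ) (∏-tabulate-cong Py≈xx λ i → P*≈p· (μ i))) ⟩
      x ^ q * ∏[ x * x - tabulate (λ i → p · μ i) ] ∎
      where
      P = p · 1#
      y = w * (x * x)

      Py≈xx : P * y ≈ x * x
      Py≈xx = trans (sym (*-assoc P w (x * x))) (trans (*-congʳ Pw≈1) (*-identityˡ _))

      P*≈p· : ∀ z → P * z ≈ p · z
      P*≈p· z = trans (×-assoc-* p 1# z) (×-congʳ p (*-identityˡ z))

      entry : ∀ i j → x * x * identity i j - sum (λ k → B i k * B j k) ≈ P * (y * identity i j - L i j)
      entry i j = begin
        x * x * identity i j - sum (λ k → B i k * B j k)
          ≈⟨ +-cong (*-congʳ (sym Py≈xx)) (-‿cong (trans (BBᵀ≈pL i j) (sym (P*≈p· (L i j))))) ⟩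
        P * y * identity i j - P * L i j
          ≈⟨ +-congʳ (*-assoc _ _ _) ⟩
        P * (y * identity i j) - P * L i j
          ≈⟨ x[y-z]≈xy-xz _ _ _ ⟨
        P * (y * identity i j - L i j) ∎

  -- Spectra

  ⟦⟧-* : ∀ s t → ⟦ s Sign.* t ⟧ ≈ ⟦ s ⟧ * ⟦ t ⟧
  ⟦⟧-* Sign.+ t      = sym (*-identityˡ ⟦ t ⟧)
  ⟦⟧-* Sign.- Sign.+ = sym (*-identityʳ (- 1#))
  ⟦⟧-* Sign.- Sign.- = sym (trans (-1*x≈-x (- 1#)) (-‿involutive 1#))

  ⟦⟧-opposite : ∀ s → ⟦ Sign.opposite s ⟧ ≈ - ⟦ s ⟧
  ⟦⟧-opposite Sign.+ = refl
  ⟦⟧-opposite Sign.- = sym (-‿involutive 1#)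

  ⟦⟧-square : ∀ s → ⟦ s ⟧ * ⟦ s ⟧ ≈ 1#
  ⟦⟧-square s = trans (sym (⟦⟧-* s s)) (reflexive (≡.cong ⟦_⟧ (Sign.s*s≡+ s)))

  sum-indicator : ∀ {k} {A : Set} {P : A → Set} (P? : Decidable P) (f : Fin k → A) {t : Vector Carrier k} →
                  (∀ i → P (f i) → t i ≈ 1#) → (∀ i → ¬ P (f i) → t i ≈ 0#) →
                  sum t ≈ length (filter P? (tabulate f)) · 1#
  sum-indicator {zero}  P? f t≈1 t≈0 = refl
  sum-indicator {suc k} P? f t≈1 t≈0 with P? (f zero)
  ... | yes Pf = +-cong (t≈1 zero Pf) (sum-indicator P? (f ∘ suc) (t≈1 ∘ suc) (t≈0 ∘ suc))
  ... | no ¬Pf = trans (+-cong (t≈0 zero ¬Pf) (sum-indicator P? (f ∘ suc) (t≈1 ∘ suc) (t≈0 ∘ suc)))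
                       (+-identityˡ _)

  -- The index runs over pairs (t , j), and the summand forgets t.
  sum-remQuot : ∀ p {m} (t : Vector Carrier m) → sum (λ q → t (proj₂ (remQuot {p} m q))) ≈ p · sum t
  sum-remQuot zero        t = refl
  sum-remQuot (suc p) {m} t = trans (sum-++ m _) (+-cong
    (sum-cong-≋ λ j → reflexive (≡.cong t (first j)))
    (trans (sum-cong-≋ λ q → reflexive (≡.cong t (rest q))) (sum-remQuot p t)))
    where
    first : ∀ j → proj₂ (remQuot {suc p} m (j ↑ˡ (p ℕ.* m))) ≡ j
    first j rewrite splitAt-↑ˡ m j (p ℕ.* m) = ≡.refl

    rest : ∀ q → proj₂ (remQuot {suc p} m (m ↑ʳ q)) ≡ proj₂ (remQuot {p} m q)
    rest q rewrite splitAt-↑ʳ m (p ℕ.* m) q = ≡.refl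

  -- Adjacency and signed incidence matrices

  module Adjacency {n m : ℕ} (Γ : SignedGraph n m) where
    open SignedGraph Γ
    open Graph Γ

    -- The search in `adjacency` may return any joining edge; in a simple graph it is the given one.
    adjacency-joins : ∀ {e u v} → Joins e u v → adjacency Γ u v ≡ ⟦ σ e ⟧
    adjacency-joins {u = u} {v} joins with adjacent? u v
    ... | yes (f , joins′) = ≡.cong (⟦_⟧ ∘ σ) (Joins-unique joins′ joins)
    ... | no ¬adjacent     = contradiction (_ , joins) ¬adjacent

    adjacency-none : ∀ {u v} → (∀ e → ¬ Joins e u v) → adjacency Γ u v ≡ 0#
    adjacency-none {u} {v} none with adjacent? u v
    ... | yes (e , joins) = contradiction joins (none e)
    ... | no _            = ≡.refl

    adjacency-sym : ∀ u v → adjacency Γ u v ≡ adjacency Γ v u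
    adjacency-sym u v with adjacent? u v
    ... | yes (e , joins) = ≡.sym (adjacency-joins (Joins-sym joins))
    ... | no ¬adjacent    = ≡.sym (adjacency-none λ e joins → ¬adjacent (e , Joins-sym joins))

    Incident⇒Joins : ∀ {e u v} → u ≢ v → Incident u e → Incident v e → Joins e u v
    Incident⇒Joins u≢v (inj₁ p) (inj₂ q) = inj₁ (p , q)
    Incident⇒Joins u≢v (inj₂ p) (inj₁ q) = inj₂ (q , p)
    Incident⇒Joins u≢v (inj₁ p) (inj₁ q) = contradiction (≡.trans (≡.sym p) q) u≢v
    Incident⇒Joins u≢v (inj₂ p) (inj₂ q) = contradiction (≡.trans (≡.sym p) q) u≢v

    Joins⇒Incident : ∀ {e u v} → Joins e u v → Incident u e × Incident v e
    Joins⇒Incident (inj₁ (p , q)) = inj₁ p , inj₂ q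
    Joins⇒Incident (inj₂ (p , q)) = inj₂ q , inj₁ p

  module Incidence {n m : ℕ} (Γ : SignedGraph n m) (o : SignedGraph.Orientation Γ) where
    open SignedGraph Γ
    open Orientation o
    open Graph Γ
    open Adjacency Γ

    incidence : Fin n → Fin m → Carrier
    incidence v e with incident? v e
    ... | yes _ = ⟦ ϑ v e ⟧
    ... | no  _ = 0#

    incidence-yes : ∀ {v e} → Incident v e → incidence v e ≡ ⟦ ϑ v e ⟧
    incidence-yes {v} {e} v∈e with incident? v e
    ... | yes _  = ≡.refl
    ... | no v∉e = contradiction v∈e v∉e

    incidence-no : ∀ {v e} → ¬ Incident v e → incidence v e ≡ 0#
    incidence-no {v} {e} v∉e with incident? v e
    ... | yes v∈e = contradiction v∈e v∉e
    ... | no _    = ≡.refl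

    ϑ-joins : ∀ {e u v} → Joins e u v → ϑ u e Sign.* ϑ v e ≡ Sign.opposite (σ e)
    ϑ-joins {e} (inj₁ (≡.refl , ≡.refl)) = oriented e
    ϑ-joins {e} (inj₂ (≡.refl , ≡.refl)) = ≡.trans (Sign.*-comm _ (ϑ (end₁ e) e)) (oriented e)

    incidence-*-zero : ∀ {e u v} → u ≢ v → ¬ Joins e u v → incidence u e * incidence v e ≈ 0#
    incidence-*-zero {e} {u} {v} u≢v ¬joins with incident? u e | incident? v e
    ... | no _    | _       = zeroˡ _
    ... | yes _   | no _    = zeroʳ _
    ... | yes u∈e | yes v∈e = contradiction (Incident⇒Joins u≢v u∈e v∈e) ¬joins

    incidence-*-joins : ∀ {e u v} → Joins e u v → incidence u e * incidence v e ≈ - ⟦ σ e ⟧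
    incidence-*-joins {e} {u} {v} joins with u∈e , v∈e ← Joins⇒Incident joins = begin
      incidence u e * incidence v e     ≡⟨ ≡.cong₂ _*_ (incidence-yes u∈e) (incidence-yes v∈e) ⟩
      ⟦ ϑ u e ⟧ * ⟦ ϑ v e ⟧             ≈⟨ ⟦⟧-* (ϑ u e) (ϑ v e) ⟨
      ⟦ ϑ u e Sign.* ϑ v e ⟧            ≡⟨ ≡.cong ⟦_⟧ (ϑ-joins joins) ⟩
      ⟦ Sign.opposite (σ e) ⟧           ≈⟨ ⟦⟧-opposite (σ e) ⟩
      - ⟦ σ e ⟧                         ∎

    -- On the diagonal each edge at u contributes a squared sign, which adds up to the degree. Off
    -- the diagonal only the edge joining u and v contributes, and there the orientation gives -σ.
    incidence-gram : ∀ u v → sum (λ e → incidence u e * incidence v e) ≈ laplacian Γ u v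
    incidence-gram u v with u ≟ v
    ... | yes ≡.refl = begin
      sum (λ e → incidence u e * incidence u e)
        ≈⟨ sum-indicator (incident? u) id
             (λ e u∈e → trans (reflexive (≡.cong (λ x → x * x) (incidence-yes u∈e))) (⟦⟧-square (ϑ u e)))
             (λ e u∉e → trans (*-congˡ (reflexive (incidence-no u∉e))) (zeroʳ _)) ⟩
      degree u · 1#
        ≈⟨ *-identityʳ _ ⟨
      degree u · 1# * 1#
        ≈⟨ minus-zero (reflexive (adjacency-none λ e → Joins-irrefl)) ⟨
      degree u · 1# * 1# - adjacency Γ u u ∎
    ... | no u≢v = begin
      sum (λ e → incidence u e * incidence v e)
        ≈⟨ off-diagonal ⟩
      - adjacency Γ u v
        ≈⟨ trans (+-congʳ (zeroʳ _)) (+-identityˡ _) ⟨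
      degree u · 1# * 0# - adjacency Γ u v ∎
      where
      off-diagonal : sum (λ e → incidence u e * incidence v e) ≈ - adjacency Γ u v
      off-diagonal with adjacent? u v
      ... | yes (e , joins) = trans
        (sum-isolate e λ f f≢e → incidence-*-zero u≢v λ joins′ → f≢e (Joins-unique joins′ joins))
        (incidence-*-joins joins)
      ... | no ¬adjacent = trans
        (sum-zero λ e → incidence-*-zero u≢v λ joins → ¬adjacent (e , joins))
        (sym -0#≈0#)

    -- Writing a column with `identity` as indicator lets sums over v collapse to the two ends.
    incidence-ends : ∀ v e → incidence v e ≈
      ⟦ ϑ (end₁ e) e ⟧ * identity v (end₁ e) + ⟦ ϑ (end₂ e) e ⟧ * identity v (end₂ e)
    incidence-ends v e with end₁ e ≟ v | end₂ e ≟ v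
    ... | yes p | yes q = contradiction (inj₁ (p , q)) Joins-irrefl
    ... | yes ≡.refl | no v≢ = sym (trans (+-cong
          (trans (*-congˡ (reflexive (identity-≡ {i = v} ≡.refl))) (*-identityʳ _))
          (trans (*-congˡ (reflexive (identity-≢ (v≢ ∘ ≡.sym)))) (zeroʳ _))) (+-identityʳ _))
    ... | no v≢ | yes ≡.refl = sym (trans (+-cong
          (trans (*-congˡ (reflexive (identity-≢ (v≢ ∘ ≡.sym)))) (zeroʳ _))
          (trans (*-congˡ (reflexive (identity-≡ {i = v} ≡.refl))) (*-identityʳ _))) (+-identityˡ _))
    ... | no v≢₁ | no v≢₂ = sym (trans (+-cong
          (trans (*-congˡ (reflexive (identity-≢ (v≢₁ ∘ ≡.sym)))) (zeroʳ _))
          (trans (*-congˡ (reflexive (identity-≢ (v≢₂ ∘ ≡.sym)))) (zeroʳ _))) (+-identityʳ _))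

    module _ (s : Fin n → Sign) (switching : Switching s) where

      -- The column of e has entries ϑ(x,e) and ϑ(y,e) with product -s(x)s(y), so after
      -- multiplication by s they are opposite signs.
      switching-incidence : ∀ e → sum (λ v → ⟦ s v ⟧ * incidence v e) ≈ 0#
      switching-incidence e = begin
        sum (λ v → ⟦ s v ⟧ * incidence v e)
          ≈⟨ sum-cong-≋ (λ v → trans (*-congˡ (incidence-ends v e))
               (trans (distribˡ _ _ _) (+-cong (sym (*-assoc _ _ _)) (sym (*-assoc _ _ _))))) ⟩
        sum (λ v → ⟦ s v ⟧ * ⟦ ϑ x e ⟧ * identity v x + ⟦ s v ⟧ * ⟦ ϑ y e ⟧ * identity v y)
          ≈⟨ ∑-distrib-+ (λ v → ⟦ s v ⟧ * ⟦ ϑ x e ⟧ * identity v x)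
                         (λ v → ⟦ s v ⟧ * ⟦ ϑ y e ⟧ * identity v y) ⟩
        sum (λ v → ⟦ s v ⟧ * ⟦ ϑ x e ⟧ * identity v x) + sum (λ v → ⟦ s v ⟧ * ⟦ ϑ y e ⟧ * identity v y)
          ≈⟨ +-cong (sum-*-identity (λ v → ⟦ s v ⟧ * ⟦ ϑ x e ⟧) x)
                    (sum-*-identity (λ v → ⟦ s v ⟧ * ⟦ ϑ y e ⟧) y) ⟩
        ⟦ s x ⟧ * ⟦ ϑ x e ⟧ + ⟦ s y ⟧ * ⟦ ϑ y e ⟧
          ≈⟨ +-cong (⟦⟧-* (s x) (ϑ x e)) (⟦⟧-* (s y) (ϑ y e)) ⟨
        ⟦ s x Sign.* ϑ x e ⟧ + ⟦ s y Sign.* ϑ y e ⟧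
          ≡⟨ ≡.cong (λ t → ⟦ s x Sign.* ϑ x e ⟧ + ⟦ t ⟧)
               (opposite-ends (s x) (s y) (ϑ x e) (ϑ y e)
                 (≡.trans (oriented e) (≡.cong Sign.opposite (switching e)))) ⟩
        ⟦ s x Sign.* ϑ x e ⟧ + ⟦ Sign.opposite (s x Sign.* ϑ x e) ⟧
          ≈⟨ +-congˡ (⟦⟧-opposite (s x Sign.* ϑ x e)) ⟩
        ⟦ s x Sign.* ϑ x e ⟧ - ⟦ s x Sign.* ϑ x e ⟧
          ≈⟨ -‿inverseʳ _ ⟩
        0# ∎
        where
        x = end₁ e
        y = end₂ e

        opposite-ends : ∀ a b α β → α Sign.* β ≡ Sign.opposite (a Sign.* b) →
                        b Sign.* β ≡ Sign.opposite (a Sign.* α)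
        opposite-ends Sign.+ Sign.+ Sign.+ Sign.- _ = ≡.refl
        opposite-ends Sign.+ Sign.+ Sign.- Sign.+ _ = ≡.refl
        opposite-ends Sign.+ Sign.- Sign.+ Sign.+ _ = ≡.refl
        opposite-ends Sign.+ Sign.- Sign.- Sign.- _ = ≡.refl
        opposite-ends Sign.- Sign.+ Sign.+ Sign.+ _ = ≡.refl
        opposite-ends Sign.- Sign.+ Sign.- Sign.- _ = ≡.refl
        opposite-ends Sign.- Sign.- Sign.+ Sign.- _ = ≡.refl
        opposite-ends Sign.- Sign.- Sign.- Sign.+ _ = ≡.refl

      -- By the Gram identity sᵀL = (sᵀB)Bᵀ, here with the incidence matrix B of Γ itself, and sᵀB =
      -- 0.
      switching-laplacian : ∀ w → sum (λ v → ⟦ s v ⟧ * laplacian Γ v w) ≈ 0#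
      switching-laplacian w = begin
        sum (λ v → ⟦ s v ⟧ * laplacian Γ v w)
          ≈⟨ sum-cong-≋ (λ v → trans (*-congˡ (sym (incidence-gram v w)))
                                     (*-distribˡ-sum ⟦ s v ⟧ (λ e → incidence v e * incidence w e))) ⟩
        sum (λ v → sum (λ e → ⟦ s v ⟧ * (incidence v e * incidence w e)))
          ≈⟨ ∑-comm (λ v e → ⟦ s v ⟧ * (incidence v e * incidence w e)) ⟩
        sum (λ e → sum (λ v → ⟦ s v ⟧ * (incidence v e * incidence w e)))
          ≈⟨ sum-zero (λ e → trans (sum-cong-≋ λ v → sym (*-assoc ⟦ s v ⟧ (incidence v e) (incidence w e)))
               (trans (sym (*-distribʳ-sum (incidence w e) (λ v → ⟦ s v ⟧ * incidence v e)))
                      (trans (*-congʳ (switching-incidence e)) (zeroˡ _)))) ⟩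
        0# ∎

    -- The adjacency matrix of S_p(Γ) in block form

    module _ (p : ℕ) where

      private
        q = p ℕ.* m
        A = adjacency (S Γ o p)
        endˢ = end Γ o p
        whichˢ = which Γ o p
        copyˢ = copy Γ o p
        edgeOfˢ = edgeOf Γ o p
        lowerˢ = lower Γ o p
        Joinsˢ = SignedGraph.Joins (S Γ o p)
        module Aˢ = Adjacency (S Γ o p)

      Joinsˢ⇒ : ∀ {x v j} → Joinsˢ x (v ↑ˡ q) (n ↑ʳ j) → lowerˢ x ≡ v × copyˢ x ≡ j
      Joinsˢ⇒ (inj₁ (eq₁ , eq₂)) = ↑ˡ-injective q _ _ eq₁ , ↑ʳ-injective n _ _ eq₂
      Joinsˢ⇒ (inj₂ (eq₁ , _))   = contradiction eq₁ (↑ˡ≢↑ʳ _ _)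

      end-incident : ∀ b e → Incident (endˢ b e) e
      end-incident zero       e = inj₁ ≡.refl
      end-incident (suc zero) e = inj₂ ≡.refl

      incident-end : ∀ {v e} → Incident v e → ∃ λ b → endˢ b e ≡ v
      incident-end (inj₁ eq) = zero , eq
      incident-end (inj₂ eq) = suc zero , eq

      adjacency-S₁₁ : ∀ u v → A (u ↑ˡ q) (v ↑ˡ q) ≡ 0#
      adjacency-S₁₁ u v = Aˢ.adjacency-none λ
        { x (inj₁ (_ , eq)) → ↑ˡ≢↑ʳ v (copyˢ x) (≡.sym eq)
        ; x (inj₂ (_ , eq)) → ↑ˡ≢↑ʳ u (copyˢ x) (≡.sym eq)
        }

      adjacency-S₂₂ : ∀ i j → A (n ↑ʳ i) (n ↑ʳ j) ≡ 0#
      adjacency-S₂₂ i j = Aˢ.adjacency-none λ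
        { x (inj₁ (eq , _)) → ↑ˡ≢↑ʳ (lowerˢ x) i eq
        ; x (inj₂ (eq , _)) → ↑ˡ≢↑ʳ (lowerˢ x) j eq
        }

      adjacency-S₁₂ : ∀ v j → A (v ↑ˡ q) (n ↑ʳ j) ≡ incidence v (edgeOfˢ j)
      adjacency-S₁₂ v j with incident? v (edgeOfˢ j)
      ... | no v∉e = Aˢ.adjacency-none λ x joins →
        let lower≡ , copy≡ = Joinsˢ⇒ {x} joins in
        v∉e (≡.subst₂ (λ u k → Incident u (edgeOfˢ k)) lower≡ copy≡
              (end-incident (whichˢ x) (edgeOfˢ (copyˢ x))))
      ... | yes v∈e with b , end≡v ← incident-end v∈e =
        ≡.trans (Aˢ.adjacency-joins {x} (inj₁ (≡.cong (_↑ˡ q) lower≡ , ≡.cong (n ↑ʳ_) copy≡)))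
                (≡.cong₂ (λ u k → ⟦ ϑ u (edgeOfˢ k) ⟧) lower≡ copy≡)
        where
        -- The edge of S_p(Γ) that joins the b-th end of the underlying edge, which is v, to the
        -- copy j.
        x = combine {2} b j

        copy≡ : copyˢ x ≡ j
        copy≡ = ≡.cong proj₂ (remQuot-combine {2} b j)

        lower≡ : lowerˢ x ≡ v
        lower≡ = ≡.trans (≡.cong₂ (λ b k → endˢ b (edgeOfˢ k))
                                  (≡.cong proj₁ (remQuot-combine {2} b j)) copy≡)
                         end≡v

      adjacency-S₂₁ : ∀ j v → A (n ↑ʳ j) (v ↑ˡ q) ≡ incidence v (edgeOfˢ j)
      adjacency-S₂₁ j v = ≡.trans (Aˢ.adjacency-sym (n ↑ʳ j) (v ↑ˡ q)) (adjacency-S₁₂ v j)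

      -- The upper right block consists of p copies of the incidence matrix of Γ side by side, so
      -- its Gram matrix is p times as large.
      incidence-S-gram : ∀ u v →
        sum (λ j → incidence u (edgeOfˢ j) * incidence v (edgeOfˢ j)) ≈ p · laplacian Γ u v
      incidence-S-gram u v = trans
        (sum-remQuot p (λ e → incidence u e * incidence v e))
        (×-congʳ p (incidence-gram u v))

      charPoly-S : .{{_ : NonZero p}} → (μ : Fin n → Carrier) → HasSpectrum (laplacian Γ) (tabulate μ) →
        ∀ x → x ^ n * charPoly A x ≈ x ^ q * ∏[ x * x - tabulate (λ i → p · μ i) ]
      charPoly-S = charPoly-spectrum A (λ v j → incidence v (edgeOfˢ j))
        (λ u v → reflexive (adjacency-S₁₁ u v)) (λ v j → reflexive (adjacency-S₁₂ v j))
        (λ j v → reflexive (adjacency-S₂₁ j v)) (λ i j → reflexive (adjacency-S₂₂ i j))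
        (laplacian Γ) p incidence-S-gram

  -- The signs `s` form a left null vector of L(Γ), and `s zero`, being its own inverse, can be
  -- removed from the conclusion of `det-dependent`.
  switching⇒det≈0 : ∀ {k m} (Γ : SignedGraph (suc k) m) → SignedGraph.Orientation Γ →
    ∀ s → Graph.Switching Γ s → charPoly (laplacian Γ) 0# ≈ 0#
  switching⇒det≈0 Γ o s switching = begin
    d                               ≈⟨ *-identityˡ d ⟨
    1# * d                          ≈⟨ *-congʳ (⟦⟧-square (s zero)) ⟨
    ⟦ s zero ⟧ * ⟦ s zero ⟧ * d     ≈⟨ *-assoc _ _ _ ⟩
    ⟦ s zero ⟧ * (⟦ s zero ⟧ * d)   ≈⟨ *-congˡ (det-dependent M (⟦_⟧ ∘ s) dependent) ⟩
    ⟦ s zero ⟧ * 0#                 ≈⟨ zeroʳ _ ⟩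
    0#                              ∎
    where
    M = λ i j → 0# * identity i j - laplacian Γ i j
    d = charPoly (laplacian Γ) 0#

    dependent : ∀ j → sum (λ i → ⟦ s i ⟧ * M i j) ≈ 0#
    dependent j = begin
      sum (λ i → ⟦ s i ⟧ * M i j)
        ≈⟨ sum-cong-≋ (λ i → trans (*-congˡ {⟦ s i ⟧} (trans (+-congʳ (zeroˡ (identity i j))) (+-identityˡ _)))
                                   (sym (-‿distribʳ-* ⟦ s i ⟧ (laplacian Γ i j)))) ⟩
      sum (λ i → - (⟦ s i ⟧ * laplacian Γ i j))
        ≈⟨ sum-neg (λ i → ⟦ s i ⟧ * laplacian Γ i j) ⟩
      - sum (λ i → ⟦ s i ⟧ * laplacian Γ i j)
        ≈⟨ trans (-‿cong (Incidence.switching-laplacian Γ o s switching j)) -0#≈0# ⟩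
      0# ∎

theorem4p2 : ∀ {c ℓ₁ ℓ₂} (K : EuclideanField c ℓ₁ ℓ₂) →
    let open EuclideanField K
        open Spectral K in
    ∀ {k m : ℕ} → let n = suc k in
    (Γ : SignedGraph n m) →
    let open SignedGraph Γ in
    Connected →
    (μ : Fin n → Carrier) →
    HasSpectrum (laplacian Γ) (tabulate μ) →
    (∀ i j → i ≤ j → μ j ≤ᶠ μ i) →
    (∀ i → 0# ≤ᶠ μ i) →
    (p : ℕ) → .{{_ : NonZero p}} →
    (ϑ : Orientation) →
    (Balanced →
      μ (fromℕ k) ≈ 0# ×
      HasSpectrum (adjacency (S Γ ϑ p))
        (replicate ((p ℕ.* m ℕ.+ 2) ∸ n) 0# ++
         concatMap (λ i → ±√ (p · μ (inject₁ i))) (allFin k)))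
    ×
    (¬ Balanced →
      HasSpectrum (adjacency (S Γ ϑ p))
        (replicate (p ℕ.* m ∸ n) 0# ++
         concatMap (λ i → ±√ (p · μ i)) (allFin n)))
theorem4p2 K {k} {m} Γ connected μ specL decreasing μ≥0 p ϑ = balancedCase , unbalancedCase
  where
  open EuclideanField K
  open CommutativeRing commutativeRing using (refl; sym; trans)
  open Spectral K
  open Mult semiring using (×-assoc-*; ×-congʳ)
  open SignedGraph Γ using (Balanced)
  open Graph Γ
  open FieldProperties K
  n = suc k
  A = adjacency (S Γ ϑ p)

  p·-zero : ∀ {x} → x ≈ 0# → p · x ≈ 0#
  p·-zero x≈0 = trans (×-congʳ p (trans x≈0 (sym (zeroʳ 1#))))
    (trans (sym (×-assoc-* p 1# 0#)) (zeroʳ _))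

  balancedCase : Balanced → μ (fromℕ k) ≈ 0# × HasSpectrum A
    (replicate ((p ℕ.* m ℕ.+ 2) ∸ n) 0# ++ concatMap (λ i → ±√ (p · μ (inject₁ i))) (allFin k))
  balancedCase balanced = μ-last , hasSpectrum-±√ A (λ i → p · μ (inject₁ i))
    (λ i → ·-nonneg p (μ≥0 (inject₁ i)))
    -- Connectedness gives n ≤ 1 + m ≤ 2 + pm, so the truncated difference loses nothing.
    (ℕ.≤-trans (connected⇒n≤1+m connected)
      (ℕ.≤-trans (ℕ.+-mono-≤ (ℕ.n≤1+n 1) (ℕ.m≤n*m m p)) (ℕ.≤-reflexive (ℕ.+-comm 2 (p ℕ.* m)))))
    (λ x → trans (Incidence.charPoly-S Γ ϑ p μ specL x) (∏-square-last x (p ℕ.* m) (λ i → p · μ i) (p·-zero μ-last)))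
    where
    μ-last : μ (fromℕ k) ≈ 0#
    -- Any vertex can be the root; `zero` exists because n is a successor. At x = 0 the vanishing
    -- determinant is the product of the -μᵢ, so the least eigenvalue is 0.
    μ-last with s , switching ← balanced⇒switching balanced connected zero =
      ∏≈0⇒last≈0 μ (λ i → decreasing i (fromℕ k) (≤fromℕ i)) (μ≥0 (fromℕ k))
        (trans (sym (specL 0#)) (switching⇒det≈0 Γ ϑ s switching))

  unbalancedCase : ¬ Balanced → HasSpectrum A
    (replicate (p ℕ.* m ∸ n) 0# ++ concatMap (λ i → ±√ (p · μ i)) (allFin n))
  -- A switching function would make Γ balanced, so the edge count n ≤ m ≤ pm remains.
  unbalancedCase unbalanced with n≤m⊎switching connected
  ... | inj₂ (s , switching) = contradiction (switching⇒balanced s switching) unbalanced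
  ... | inj₁ n≤m = hasSpectrum-±√ A (λ i → p · μ i) (λ i → ·-nonneg p (μ≥0 i))
    (ℕ.≤-trans n≤m (ℕ.m≤n*m m p)) (Incidence.charPoly-S Γ ϑ p μ specL)
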